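{- Let $p>3$ be a prime. Then the following polynomial congruences hold in $\mathbb{Z}_{(p)}[t]$: \begin{align*} p\sum_{k=1}^{p-1} \frac{t^{k}}{k\binom{2k}{k}} &\equiv \frac{t\,u_p(2-t)-t^p}{2}+p^2\, t\sum_{k=1}^{p-1} \frac{u_{k}(2-t)}{k^2} \pmod{p^3},\\ p\sum_{k=1}^{p-1} \frac{t^{k}}{k^2\binom{2k}{k}} &\equiv \frac{2-v_p(2-t)-t^p}{2p}-p^2 \sum_{k=1}^{p-1} \frac{v_{k}(2-t)}{k^3} \pmod{p^3},\\ p\sum_{k=1}^{p-1} \frac{t^{k}H_{k-1}(2)}{k\binom{2k}{k}} &\equiv t\sum_{k=1}^{p-1} \frac{u_{k}(2-t)}{k^2} \pmod{p},\\ p\sum_{k=1}^{p-1} \frac{t^{k}H_{k-1}(2)}{k^2\binom{2k}{k}} &\equiv -\sum_{k=1}^{p-1} \frac{v_{k}(2-t)}{k^3} \pmod{p}. \end{align*}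
   Context: The Lucas polynomials $u_n(x),v_n(x)\in\mathbb{Z}[x]$ are defined by $u_0=0$, $u_1=1$, $u_n(x)=x\,u_{n-1}(x)-u_{n-2}(x)$ for $n>1$, and $v_0=2$, $v_1=x$, $v_n(x)=x\,v_{n-1}(x)-v_{n-2}(x)$ for $n>1$. For positive integers $k,s$, $H_k(s)=\sum_{r=1}^k 1/r^s$, and $H_0(s)=0$. $\mathbb{Z}_{(p)}$ denotes the rationals whose denominators are prime to $p$; for polynomials $A,B\in\mathbb{Q}[t]$, $A\equiv B\pmod{p^m}$ means that $A-B\in p^m\mathbb{Z}_{(p)}[t]$. -}

module Defs where

open import Data.Nat as ℕ using (ℕ; zero; suc)
open import Data.Nat.Divisibility using (_∣_)
open import Data.Nat.Combinatorics using (_C_)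
open import Data.Integer using (+_)
open import Data.Rational as ℚ using (ℚ; 0ℚ; 1ℚ)
open import Data.List using (List; []; _∷_)
open import Data.Product using (∃; _×_)
open import Relation.Binary.PropositionalEquality using (_≡_)
open import Relation.Nullary using (¬_)

ℕ→ℚ : ℕ → ℚ
ℕ→ℚ n = (+ n) ℚ./ 1

-- reciprocal of a natural number (only ever applied to positive arguments;
-- the value at 0 is an irrelevant convention)
recipℕ : ℕ → ℚ
recipℕ zero    = 0ℚ
recipℕ (suc n) = (+ 1) ℚ./ suc n

sum1 : {A : Set} → A → (A → A → A) → ℕ → (ℕ → A) → A
sum1 z _⊕_ zero    f = z
sum1 z _⊕_ (suc n) f = sum1 z _⊕_ n f ⊕ f (suc n)

H : ℕ → ℕ → ℚ
H k s = sum1 0ℚ ℚ._+_ k (λ r → recipℕ (r ℕ.^ s))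

-- Polynomials in ℚ[t] as coefficient lists (lowest degree first)

Poly : Set
Poly = List ℚ

coeff : Poly → ℕ → ℚ
coeff []       _       = 0ℚ
coeff (a ∷ as) zero    = a
coeff (a ∷ as) (suc i) = coeff as i

infixl 6 _⊕_ _⊖_
infixl 7 _⊗_ _·_

_⊕_ : Poly → Poly → Poly
[]       ⊕ q        = q
(a ∷ as) ⊕ []       = a ∷ as
(a ∷ as) ⊕ (b ∷ bs) = (a ℚ.+ b) ∷ (as ⊕ bs)

_·_ : ℚ → Poly → Poly
c · []       = []
c · (a ∷ as) = (c ℚ.* a) ∷ (c · as)

⊝_ : Poly → Poly
⊝ q = (ℚ.- 1ℚ) · q

_⊖_ : Poly → Poly → Poly
p ⊖ q = p ⊕ (⊝ q)

_⊗_ : Poly → Poly → Poly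
[]       ⊗ q = []
(a ∷ as) ⊗ q = (a · q) ⊕ (0ℚ ∷ (as ⊗ q))

const : ℚ → Poly
const c = c ∷ []

T : Poly
T = 0ℚ ∷ 1ℚ ∷ []

T^ : ℕ → Poly
T^ zero    = const 1ℚ
T^ (suc n) = T ⊗ T^ n

zeroP : Poly
zeroP = []

_∘P_ : Poly → Poly → Poly
[]       ∘P g = []
(a ∷ as) ∘P g = const a ⊕ (g ⊗ (as ∘P g))

sumP : ℕ → (ℕ → Poly) → Poly
sumP = sum1 zeroP _⊕_

lucasU : ℕ → Poly
lucasU zero          = zeroP
lucasU (suc zero)    = const 1ℚ
lucasU (suc (suc n)) = (T ⊗ lucasU (suc n)) ⊖ lucasU n

lucasV : ℕ → Poly
lucasV zero          = const (ℕ→ℚ 2)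
lucasV (suc zero)    = T
lucasV (suc (suc n)) = (T ⊗ lucasV (suc n)) ⊖ lucasV n

twoMinusT : Poly
twoMinusT = const (ℕ→ℚ 2) ⊖ T

InPowZp : ℕ → ℕ → ℚ → Set
InPowZp p m q = ∃ λ r → (¬ (p ∣ ℚ.denominatorℕ r)) × (q ≡ ℕ→ℚ (p ℕ.^ m) ℚ.* r)

CongP : ℕ → ℕ → Poly → Poly → Set
CongP p m A B = ∀ i → InPowZp p m (coeff (A ⊖ B) i)

{-# OPTIONS --safe #-}
module Submission where

-- Write k = j + 1. The coefficient of tʲ in u_n(2 - t) is C_j(n) / (2j+1)! with
-- C_j(x) = x ∏_{i≤j} (i² - x²), and k [tᵏ] v_n(2 - t) = - n [tʲ] u_n(2 - t). As
-- 1 / (k binom(2k,k)) = j!² / (2 (2j+1)!), the second and fourth congruences are, at tᵏ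
-- with k ≥ 1, the first and third divided by k, and the expansion
-- C_j(p) ≡ p j!² (1 - p² H_j(2)) (mod p⁵) reduces the first to the third.
--
-- Since p / (2j+1)! is p-integral, the third follows from
-- S_j := ∑_{m<p} C_j(m) / m² ≡ (p/2) j!² H_j(2) (mod p²), by induction on j from
-- S_{j+1} = (j+1)² S_j - ∑_{m<p} C_j(m): up to sign C_j(m) is a product of consecutive
-- integers, so the last sum telescopes, and it is ≡ - (p/2) j!². The base case S_0 is
-- Wolstenholme's congruence H_{p-1}(1) ≡ 0 (mod p²).

open import Defs
open import Data.Nat using (ℕ; _<_; _∸_; _*_; _^_)
open import Data.Nat.Primality using (Prime)
open import Data.Nat.Combinatorics using (_C_)
open import Data.Rational using (ℚ; 1ℚ)
open import Data.Product using (_×_)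

open import Data.Nat as ℕ using (zero; suc; _≤_; z≤n; s≤s; _!)
import Data.Nat.Properties as ℕₚ
open import Data.Nat.Properties using (_!≢0; _!*_!≢0)
open import Data.Nat.Divisibility using (_∣_; _∣0; divides; ∣-refl; ∣-trans; ∣⇒≤; ∣m+n∣m⇒∣n)
open import Data.Nat.DivMod using (m/n*n≡m)
open import Data.Nat.Combinatorics using (nCk≡n!/k![n-k]!)
open import Data.Nat.Combinatorics.Specification using ([n∸k]!k!∣n!)
open import Data.Nat.Solver using () renaming (module +-*-Solver to ℕ-Solver)
open import Data.Nat.Coprimality using (coprime-divisor)
import Data.Nat.Coprimality as Coprimality
open import Data.Nat.Primality using (euclidsLemma; prime⇒nonZero; prime⇒nonTrivial; prime⇒irreducible)
open import Data.Integer as ℤ using () renaming (+_ to pos)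
import Data.Integer.Properties as ℤₚ
open import Data.Rational as ℚ using (0ℚ; _+_; _-_; -_; _/_; toℚᵘ; fromℚᵘ) renaming (_*_ to infixl 7 _⋆_)
import Data.Rational.Properties as ℚₚ
open import Data.Rational.Solver using (module +-*-Solver)
open import Data.Rational.Unnormalised as ℚᵘ using (mkℚᵘ; *≡*; _≃_)
import Data.Rational.Unnormalised.Properties as ℚᵘₚ
open import Data.Product using (∃; _,_; proj₁; proj₂)
open import Data.Sum using (_⊎_; inj₁; inj₂; [_,_]′)
open import Data.List using ([]; _∷_)
open import Relation.Nullary using (¬_; yes; no; contradiction)
open import Relation.Binary.PropositionalEquality using (_≡_; _≢_; refl; sym; trans; cong; cong₂; subst; module ≡-Reasoning)
open import Function using (_∘_; id)
open +-*-Solver using (solve; con; _:=_; _:+_; _:*_; _:-_; :-_)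
open ℕ-Solver using () renaming (solve to ℕ-solve; _:+_ to infixl 6 _⊞_; _:*_ to infixl 7 _⊛_; _:=_ to infix 4 _⊜_)
open ≡-Reasoning

-- Rationals and finite sums

-- At x = n the quotient C_j(n) / (2j+1)! is (-1)ʲ binom(n+j, 2j+1). The polynomial form is kept
-- because x = p has to be inserted and expanded: C_j(x) / x is a polynomial in x², so only even
-- powers of p appear. The prime p can do harm in two places. For p ≤ 2j + 1 < 2p the factorial
-- (2j+1)! contains p exactly once; a division by it costs one power of p, and so S_j has to be
-- known modulo p² for a congruence modulo p. In degree k = p the division by k would cost a power
-- too; but there both sides agree exactly, since the leading term of t u_p(2 - t) is tᵖ and all
-- other sums stop below degree p. At t⁰, where no division by k is possible, the second and fourth
-- congruences amount to ∑_{m<p} 1/m³ ≡ 0 (mod p).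

≃⇒≡fromℚᵘ : ∀ {x u} → toℚᵘ x ≃ u → x ≡ fromℚᵘ u
≃⇒≡fromℚᵘ {x} e = trans (sym (ℚₚ.fromℚᵘ-toℚᵘ x)) (ℚₚ.fromℚᵘ-cong e)

fromℚᵘ-homo-+ : ∀ u v → fromℚᵘ (u ℚᵘ.+ v) ≡ fromℚᵘ u + fromℚᵘ v
fromℚᵘ-homo-+ u v = sym (≃⇒≡fromℚᵘ (ℚᵘₚ.≃-trans (ℚₚ.toℚᵘ-homo-+ (fromℚᵘ u) (fromℚᵘ v))
  (ℚᵘₚ.+-cong (ℚₚ.toℚᵘ-fromℚᵘ u) (ℚₚ.toℚᵘ-fromℚᵘ v))))

fromℚᵘ-homo-* : ∀ u v → fromℚᵘ (u ℚᵘ.* v) ≡ fromℚᵘ u ⋆ fromℚᵘ v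
fromℚᵘ-homo-* u v = sym (≃⇒≡fromℚᵘ (ℚᵘₚ.≃-trans (ℚₚ.toℚᵘ-homo-* (fromℚᵘ u) (fromℚᵘ v))
  (ℚᵘₚ.*-cong (ℚₚ.toℚᵘ-fromℚᵘ u) (ℚₚ.toℚᵘ-fromℚᵘ v))))

/1-homo-+ : ∀ a b → (a ℤ.+ b) / 1 ≡ a / 1 + b / 1
/1-homo-+ a b = trans
  (ℚₚ.fromℚᵘ-cong {mkℚᵘ (a ℤ.+ b) 0} {mkℚᵘ a 0 ℚᵘ.+ mkℚᵘ b 0}
    (*≡* (cong (ℤ._* pos 1) (sym (cong₂ ℤ._+_ (ℤₚ.*-identityʳ a) (ℤₚ.*-identityʳ b))))))
  (fromℚᵘ-homo-+ (mkℚᵘ a 0) (mkℚᵘ b 0))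

/1-homo-* : ∀ a b → (a ℤ.* b) / 1 ≡ a / 1 ⋆ (b / 1)
/1-homo-* a b = fromℚᵘ-homo-* (mkℚᵘ a 0) (mkℚᵘ b 0)

ℕ→ℚ-+ : ∀ m n → ℕ→ℚ (m ℕ.+ n) ≡ ℕ→ℚ m + ℕ→ℚ n
ℕ→ℚ-+ m n = /1-homo-+ (pos m) (pos n)

ℕ→ℚ-* : ∀ m n → ℕ→ℚ (m * n) ≡ ℕ→ℚ m ⋆ ℕ→ℚ n
ℕ→ℚ-* m n = trans (cong (_/ 1) (ℤₚ.pos-* m n)) (/1-homo-* (pos m) (pos n))

ℕ→ℚ-suc : ∀ n → ℕ→ℚ (suc n) ≡ 1ℚ + ℕ→ℚ n
ℕ→ℚ-suc = ℕ→ℚ-+ 1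

recipℕ-inverse : ∀ n .{{_ : ℕ.NonZero n}} → recipℕ n ⋆ ℕ→ℚ n ≡ 1ℚ
recipℕ-inverse (suc n) = trans (sym (fromℚᵘ-homo-* (mkℚᵘ (pos 1) n) (mkℚᵘ (pos (suc n)) 0)))
  (ℚₚ.fromℚᵘ-cong {mkℚᵘ (pos 1) n ℚᵘ.* mkℚᵘ (pos (suc n)) 0} {mkℚᵘ (pos 1) 0}
    (*≡* (trans (ℤₚ.*-identityʳ _) (cong pos (cong suc (trans (ℕₚ.+-identityʳ n) (sym (trans (ℕₚ.+-identityʳ _) (ℕₚ.*-identityʳ n)))))))))

recipℕ-unique : ∀ n .{{_ : ℕ.NonZero n}} {x y} → ℕ→ℚ n ⋆ x ≡ y → x ≡ recipℕ n ⋆ y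
recipℕ-unique n {x} {y} e = begin
  x                        ≡⟨ ℚₚ.*-identityˡ x ⟨
  1ℚ ⋆ x                   ≡⟨ cong (_⋆ x) (recipℕ-inverse n) ⟨
  recipℕ n ⋆ ℕ→ℚ n ⋆ x     ≡⟨ ℚₚ.*-assoc (recipℕ n) (ℕ→ℚ n) x ⟩
  recipℕ n ⋆ (ℕ→ℚ n ⋆ x)   ≡⟨ cong (recipℕ n ⋆_) e ⟩
  recipℕ n ⋆ y             ∎

-- The convention `recipℕ zero = 0ℚ` keeps reciprocals multiplicative when a factor is zero.
recipℕ-* : ∀ m n → recipℕ (m * n) ≡ recipℕ m ⋆ recipℕ n
recipℕ-* zero    n       = sym (ℚₚ.*-zeroˡ (recipℕ n))
recipℕ-* (suc m) zero    = trans (cong recipℕ (ℕₚ.*-zeroʳ m)) (sym (ℚₚ.*-zeroʳ (recipℕ (suc m))))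
recipℕ-* (suc m) (suc n) = fromℚᵘ-homo-* (mkℚᵘ (pos 1) m) (mkℚᵘ (pos 1) n)

recipℕ-^2 : ∀ n → recipℕ (n ^ 2) ≡ recipℕ n ⋆ recipℕ n
recipℕ-^2 n = trans (cong recipℕ (cong (n *_) (ℕₚ.*-identityʳ n))) (recipℕ-* n n)

recipℕ-^3 : ∀ n → recipℕ (n ^ 3) ≡ recipℕ n ⋆ (recipℕ n ⋆ recipℕ n)
recipℕ-^3 n = trans (recipℕ-* n (n ^ 2)) (cong (recipℕ n ⋆_) (recipℕ-^2 n))

∑ : ℕ → (ℕ → ℚ) → ℚ
∑ = sum1 0ℚ _+_

∑-cong : ∀ n {f g : ℕ → ℚ} → (∀ i → i < n → f (suc i) ≡ g (suc i)) → ∑ n f ≡ ∑ n g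
∑-cong zero    e = refl
∑-cong (suc n) e = cong₂ _+_ (∑-cong n λ i i<n → e i (ℕₚ.m<n⇒m<1+n i<n)) (e n ℕₚ.≤-refl)

∑-+ : ∀ n (f g : ℕ → ℚ) → ∑ n (λ i → f i + g i) ≡ ∑ n f + ∑ n g
∑-+ zero    f g = refl
∑-+ (suc n) f g = trans (cong (_+ (f (suc n) + g (suc n))) (∑-+ n f g))
  (solve 4 (λ a b c d → (a :+ b) :+ (c :+ d) := (a :+ c) :+ (b :+ d)) refl (∑ n f) (∑ n g) (f (suc n)) (g (suc n)))

∑-⋆ : ∀ n c (f : ℕ → ℚ) → ∑ n (λ i → c ⋆ f i) ≡ c ⋆ ∑ n f
∑-⋆ zero    c f = sym (ℚₚ.*-zeroʳ c)
∑-⋆ (suc n) c f = trans (cong (_+ (c ⋆ f (suc n))) (∑-⋆ n c f)) (sym (ℚₚ.*-distribˡ-+ c (∑ n f) (f (suc n))))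

∑-- : ∀ n (f g : ℕ → ℚ) → ∑ n (λ i → f i - g i) ≡ ∑ n f - ∑ n g
∑-- zero    f g = refl
∑-- (suc n) f g = trans (cong (_+ (f (suc n) - g (suc n))) (∑-- n f g))
  (solve 4 (λ a b c d → (a :- b) :+ (c :- d) := (a :+ c) :- (b :+ d)) refl (∑ n f) (∑ n g) (f (suc n)) (g (suc n)))

∑-0 : ∀ n → ∑ n (λ _ → 0ℚ) ≡ 0ℚ
∑-0 zero    = refl
∑-0 (suc n) = cong (_+ 0ℚ) (∑-0 n)

∑-head : ∀ n f → ∑ (suc n) f ≡ f 1 + ∑ n (λ i → f (suc i))
∑-head zero    f = ℚₚ.+-comm 0ℚ (f 1)
∑-head (suc n) f = trans (cong (_+ f (suc (suc n))) (∑-head n f)) (ℚₚ.+-assoc (f 1) _ _)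

∑-reverse : ∀ n f → ∑ n f ≡ ∑ n (λ i → f (suc n ∸ i))
∑-reverse zero    f = refl
∑-reverse (suc n) f = trans (ℚₚ.+-comm (∑ n f) (f (suc n)))
  (trans (cong (f (suc n) +_) (∑-reverse n f)) (sym (∑-head n (λ i → f (suc (suc n) ∸ i)))))

∑-split : ∀ m n f → ∑ (m ℕ.+ n) f ≡ ∑ m f + ∑ n (λ i → f (m ℕ.+ i))
∑-split m zero    f = trans (cong (λ k → ∑ k f) (ℕₚ.+-identityʳ m)) (sym (ℚₚ.+-identityʳ _))
∑-split m (suc n) f = trans (cong (λ k → ∑ k f) (ℕₚ.+-suc m n)) (trans (cong₂ _+_ (∑-split m n f) (cong f (sym (ℕₚ.+-suc m n))))
  (ℚₚ.+-assoc (∑ m f) _ _))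

-- Indices start at 1, so `ℕ.pred (i ℕ.+ i)` is the odd number 2i - 1.
∑-evenOdd : ∀ h f → ∑ (h ℕ.+ h) f ≡ ∑ h (λ i → f (i ℕ.+ i)) + ∑ h (λ i → f (ℕ.pred (i ℕ.+ i)))
∑-evenOdd zero    f = refl
∑-evenOdd (suc h) f = trans (cong (λ k → ∑ k f) (cong suc (ℕₚ.+-suc h h)))
  (trans (cong₂ _+_ (cong₂ _+_ (∑-evenOdd h f) (cong f (sym (ℕₚ.+-suc h h)))) (cong f (cong suc (sym (ℕₚ.+-suc h h)))))
  (solve 4 (λ a b c d → (a :+ b :+ c) :+ d := (a :+ d) :+ (b :+ c)) refl (∑ h λ i → f (i ℕ.+ i)) (∑ h λ i → f (ℕ.pred (i ℕ.+ i))) (f (h ℕ.+ suc h)) (f (suc (h ℕ.+ suc h)))))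

-- Localisation at p

module Localisation (p : ℕ) (isPrime : Prime p) where

  private instance
    p≢0 : ℕ.NonZero p
    p≢0 = prime⇒nonZero isPrime

  π : ℚ
  π = ℕ→ℚ p

  -- Any denominator `d` prime to p can be the witness, so closure under sums and products just
  -- multiplies witnesses. The reduced denominator, which `InPowZp` speaks of, enters only in
  -- `Integral⇒p∤denominator`.
  Integral : ℚ → Set
  Integral q = ∃ λ d → ¬ (p ∣ d) × ∃ λ z → ℕ→ℚ d ⋆ q ≡ z / 1

  record Div (m : ℕ) (q : ℚ) : Set where
    constructor div
    field
      quotient          : ℚ
      integral          : Integral quotient
      equality : q ≡ ℕ→ℚ (p ^ m) ⋆ quotient

  p∤* : ∀ {m n} → ¬ (p ∣ m) → ¬ (p ∣ n) → ¬ (p ∣ m * n)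
  p∤* {m} {n} p∤m p∤n = [ p∤m , p∤n ]′ ∘ euclidsLemma m n isPrime

  p∤1 : ¬ (p ∣ 1)
  p∤1 p∣1 = ℕₚ.<⇒≱ (ℕ.nonTrivial⇒n>1 p {{prime⇒nonTrivial isPrime}}) (∣⇒≤ p∣1)

  p∤small : ∀ {n} → n < p → .{{_ : ℕ.NonZero n}} → ¬ (p ∣ n)
  p∤small n<p = ℕₚ.<⇒≱ n<p ∘ ∣⇒≤

  Integral-/1 : ∀ z → Integral (z / 1)
  Integral-/1 z = 1 , p∤1 , z , ℚₚ.*-identityˡ (z / 1)

  Integral-ℕ : ∀ n → Integral (ℕ→ℚ n)
  Integral-ℕ n = Integral-/1 (pos n)

  Integral-+ : ∀ {x y} → Integral x → Integral y → Integral (x + y)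
  Integral-+ {x} {y} (d , p∤d , z , e) (d′ , p∤d′ , z′ , e′) =
    d * d′ , p∤* p∤d p∤d′ , pos d′ ℤ.* z ℤ.+ pos d ℤ.* z′ , (begin
      ℕ→ℚ (d * d′) ⋆ (x + y)                                ≡⟨ cong (_⋆ (x + y)) (ℕ→ℚ-* d d′) ⟩
      ℕ→ℚ d ⋆ ℕ→ℚ d′ ⋆ (x + y)                              ≡⟨ solve 4 (λ d d′ x y → d :* d′ :* (x :+ y) := d′ :* (d :* x) :+ d :* (d′ :* y)) refl (ℕ→ℚ d) (ℕ→ℚ d′) x y ⟩
      ℕ→ℚ d′ ⋆ (ℕ→ℚ d ⋆ x) + ℕ→ℚ d ⋆ (ℕ→ℚ d′ ⋆ y)           ≡⟨ cong₂ (λ a b → ℕ→ℚ d′ ⋆ a + ℕ→ℚ d ⋆ b) e e′ ⟩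
      ℕ→ℚ d′ ⋆ (z / 1) + ℕ→ℚ d ⋆ (z′ / 1)                   ≡⟨ cong₂ _+_ (/1-homo-* (pos d′) z) (/1-homo-* (pos d) z′) ⟨
      (pos d′ ℤ.* z) / 1 + (pos d ℤ.* z′) / 1               ≡⟨ /1-homo-+ (pos d′ ℤ.* z) (pos d ℤ.* z′) ⟨
      (pos d′ ℤ.* z ℤ.+ pos d ℤ.* z′) / 1                   ∎)

  Integral-⋆ : ∀ {x y} → Integral x → Integral y → Integral (x ⋆ y)
  Integral-⋆ {x} {y} (d , p∤d , z , e) (d′ , p∤d′ , z′ , e′) =
    d * d′ , p∤* p∤d p∤d′ , z ℤ.* z′ , (begin
      ℕ→ℚ (d * d′) ⋆ (x ⋆ y)                ≡⟨ cong (_⋆ (x ⋆ y)) (ℕ→ℚ-* d d′) ⟩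
      ℕ→ℚ d ⋆ ℕ→ℚ d′ ⋆ (x ⋆ y)              ≡⟨ solve 4 (λ d d′ x y → d :* d′ :* (x :* y) := (d :* x) :* (d′ :* y)) refl (ℕ→ℚ d) (ℕ→ℚ d′) x y ⟩
      (ℕ→ℚ d ⋆ x) ⋆ (ℕ→ℚ d′ ⋆ y)            ≡⟨ cong₂ _⋆_ e e′ ⟩
      (z / 1) ⋆ (z′ / 1)                    ≡⟨ /1-homo-* z z′ ⟨
      (z ℤ.* z′) / 1                        ∎)

  Integral-neg : ∀ {x} → Integral x → Integral (- x)
  Integral-neg {x} i = subst Integral (solve 1 (λ x → con (- 1ℚ) :* x := :- x) refl x) (Integral-⋆ (Integral-/1 (ℤ.- pos 1)) i)

  Integral-- : ∀ {x y} → Integral x → Integral y → Integral (x - y)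
  Integral-- i j = Integral-+ i (Integral-neg j)

  Integral-∑ : ∀ n {f} → (∀ i → i < n → Integral (f (suc i))) → Integral (∑ n f)
  Integral-∑ zero    h = Integral-ℕ 0
  Integral-∑ (suc n) h = Integral-+ (Integral-∑ n λ i i<n → h i (ℕₚ.m<n⇒m<1+n i<n)) (h n ℕₚ.≤-refl)

  Integral-recip : ∀ {n} → ¬ (p ∣ n) → Integral (recipℕ n)
  Integral-recip {zero}  p∤0 = contradiction (p ∣0) p∤0
  Integral-recip {suc n} p∤n = suc n , p∤n , pos 1 , trans (ℚₚ.*-comm (ℕ→ℚ (suc n)) (recipℕ (suc n))) (recipℕ-inverse (suc n))

  Integral-recip< : ∀ {n} → suc n < p → Integral (recipℕ (suc n))
  Integral-recip< n<p = Integral-recip (p∤small n<p)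

  -- Cross-multiplying d q = z shows that the reduced denominator divides d times the numerator. It
  -- is coprime to the numerator, hence divides d, which p does not.
  Integral⇒p∤denominator : ∀ {q} → Integral q → ¬ (p ∣ ℚ.denominatorℕ q)
  Integral⇒p∤denominator {q@(ℚ.mkℚ n d-1 c)} (d , p∤d , z , e) p∣den = p∤d (∣-trans p∣den den∣d)
    where
    dq≃z : mkℚᵘ (pos d) 0 ℚᵘ.* toℚᵘ q ≃ mkℚᵘ z 0
    dq≃z = ℚᵘₚ.≃-trans (ℚᵘₚ.*-congʳ {toℚᵘ q} (ℚᵘₚ.≃-sym (ℚₚ.toℚᵘ-fromℚᵘ (mkℚᵘ (pos d) 0))))
      (ℚᵘₚ.≃-trans (ℚᵘₚ.≃-sym (ℚₚ.toℚᵘ-homo-* (ℕ→ℚ d) q))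
      (ℚᵘₚ.≃-trans (ℚₚ.toℚᵘ-cong e) (ℚₚ.toℚᵘ-fromℚᵘ (mkℚᵘ z 0))))
    cross : d * ℤ.∣ n ∣ ≡ ℤ.∣ z ∣ * suc d-1
    cross with *≡* h ← dq≃z = begin
      d * ℤ.∣ n ∣                     ≡⟨ ℤₚ.abs-* (pos d) n ⟨
      ℤ.∣ pos d ℤ.* n ∣               ≡⟨ cong ℤ.∣_∣ (ℤₚ.*-identityʳ (pos d ℤ.* n)) ⟨
      ℤ.∣ pos d ℤ.* n ℤ.* pos 1 ∣     ≡⟨ cong ℤ.∣_∣ h ⟩
      ℤ.∣ z ℤ.* (pos 1 ℤ.* pos (suc d-1)) ∣ ≡⟨ cong (λ w → ℤ.∣ z ℤ.* w ∣) (ℤₚ.*-identityˡ (pos (suc d-1))) ⟩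
      ℤ.∣ z ℤ.* pos (suc d-1) ∣       ≡⟨ ℤₚ.abs-* z (pos (suc d-1)) ⟩
      ℤ.∣ z ∣ * suc d-1               ∎
    den∣d : suc d-1 ∣ d
    den∣d = coprime-divisor (Coprimality.sym (Coprimality.recompute c)) (divides ℤ.∣ z ∣ (trans (ℕₚ.*-comm ℤ.∣ n ∣ d) cross))

  Div⇒InPowZp : ∀ {m q} → Div m q → InPowZp p m q
  Div⇒InPowZp (div r i e) = r , Integral⇒p∤denominator i , e

  Div-0 : ∀ m → Div m 0ℚ
  Div-0 m = div 0ℚ (Integral-ℕ 0) (sym (ℚₚ.*-zeroʳ (ℕ→ℚ (p ^ m))))

  Div-+ : ∀ {m x y} → Div m x → Div m y → Div m (x + y)
  Div-+ {m} (div r i refl) (div s j refl) =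
    div (r + s) (Integral-+ i j) (sym (ℚₚ.*-distribˡ-+ (ℕ→ℚ (p ^ m)) r s))

  Div-scale : ∀ {m c x} → Integral c → Div m x → Div m (c ⋆ x)
  Div-scale {m} {c} i (div r j refl) = div (c ⋆ r) (Integral-⋆ i j)
    (solve 3 (λ q c r → c :* (q :* r) := q :* (c :* r)) refl (ℕ→ℚ (p ^ m)) c r)

  Div-neg : ∀ {m x} → Div m x → Div m (- x)
  Div-neg {m} (div r i refl) = div (- r) (Integral-neg i) (ℚₚ.neg-distribʳ-* (ℕ→ℚ (p ^ m)) r)

  Div-- : ∀ {m x y} → Div m x → Div m y → Div m (x - y)
  Div-- d e = Div-+ d (Div-neg e)

  Div-π⋆ : ∀ {m x} → Div m x → Div (suc m) (π ⋆ x)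
  Div-π⋆ {m} (div r i refl) =
    div r i (trans (sym (ℚₚ.*-assoc π (ℕ→ℚ (p ^ m)) r)) (cong (_⋆ r) (sym (ℕ→ℚ-* p (p ^ m)))))

  -- Dividing by an element whose p-adic valuation is at most 1 loses at most one power of p.
  Div-unscale : ∀ {m c x} → Integral (π ⋆ c) → Div (suc m) x → Div m (c ⋆ x)
  Div-unscale {m} {c} i (div r j refl) = div (π ⋆ c ⋆ r) (Integral-⋆ i j) (begin
    c ⋆ (ℕ→ℚ (p * p ^ m) ⋆ r)       ≡⟨ cong (λ a → c ⋆ (a ⋆ r)) (ℕ→ℚ-* p (p ^ m)) ⟩
    c ⋆ (π ⋆ ℕ→ℚ (p ^ m) ⋆ r)       ≡⟨ solve 4 (λ c π q r → c :* (π :* q :* r) := q :* (π :* c :* r)) refl c π (ℕ→ℚ (p ^ m)) r ⟩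
    ℕ→ℚ (p ^ m) ⋆ (π ⋆ c ⋆ r)       ∎)

  Div-weaken : ∀ {m x} → Div (suc m) x → Div m x
  Div-weaken {m} (div r i refl) = div (π ⋆ r) (Integral-⋆ (Integral-ℕ p) i)
    (trans (cong (_⋆ r) (trans (ℕ→ℚ-* p (p ^ m)) (ℚₚ.*-comm π (ℕ→ℚ (p ^ m))))) (ℚₚ.*-assoc (ℕ→ℚ (p ^ m)) π r))

  Integral⇒Div-0 : ∀ {x} → Integral x → Div 0 x
  Integral⇒Div-0 {x} i = div x i (sym (ℚₚ.*-identityˡ x))

  Div-∑ : ∀ {m} n {f} → (∀ i → i < n → Div m (f (suc i))) → Div m (∑ n f)
  Div-∑ {m} zero h = Div-0 m
  Div-∑ (suc n) h = Div-+ (Div-∑ n λ i i<n → h i (ℕₚ.m<n⇒m<1+n i<n)) (h n ℕₚ.≤-refl)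

  Integral-recip-! : ∀ n → n < p → Integral (recipℕ (n !))
  Integral-recip-! zero    _   = Integral-ℕ 1
  Integral-recip-! (suc n) n<p = subst Integral (sym (recipℕ-* (suc n) (n !)))
    (Integral-⋆ (Integral-recip< n<p) (Integral-recip-! n (ℕₚ.<-trans (ℕₚ.n<1+n n) n<p)))

  π⋆recip≡1 : π ⋆ recipℕ p ≡ 1ℚ
  π⋆recip≡1 = trans (ℚₚ.*-comm π (recipℕ p)) (recipℕ-inverse p)

  Integral-π⋆recip-p! : ∀ q → p ≡ suc q → Integral (π ⋆ recipℕ (p !))
  Integral-π⋆recip-p! q refl = subst Integral
    (trans (sym (ℚₚ.*-identityˡ (recipℕ (q !)))) (trans (cong (_⋆ recipℕ (q !)) (sym π⋆recip≡1))
      (trans (ℚₚ.*-assoc π (recipℕ p) (recipℕ (q !))) (cong (π ⋆_) (sym (recipℕ-* p (q !)))))))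
    (Integral-recip-! q ℕₚ.≤-refl)

  Integral-π⋆recip-[p+i]! : ∀ i → i < p → Integral (π ⋆ recipℕ ((p ℕ.+ i) !))
  Integral-π⋆recip-[p+i]! zero _ = subst (λ n → Integral (π ⋆ recipℕ (n !))) (sym (ℕₚ.+-identityʳ p))
    (Integral-π⋆recip-p! (ℕ.pred p) (sym (ℕₚ.suc-pred p)))
  Integral-π⋆recip-[p+i]! (suc i) i<p = subst (λ n → Integral (π ⋆ recipℕ (n !))) (sym (ℕₚ.+-suc p i))
    (subst Integral (trans
        (solve 3 (λ a π b → a :* (π :* b) := π :* (a :* b)) refl (recipℕ (suc (p ℕ.+ i))) π (recipℕ ((p ℕ.+ i) !)))
        (cong (π ⋆_) (sym (recipℕ-* (suc (p ℕ.+ i)) ((p ℕ.+ i) !)))))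
      (Integral-⋆ (Integral-recip p∤) (Integral-π⋆recip-[p+i]! i (ℕₚ.<-trans (ℕₚ.n<1+n i) i<p))))
    where
    p∤ : ¬ (p ∣ suc (p ℕ.+ i))
    p∤ h = p∤small i<p (∣m+n∣m⇒∣n (subst (p ∣_) (sym (ℕₚ.+-suc p i)) h) ∣-refl)

  -- For n < 2p the only factor of n! that p can divide is p itself, and it is cancelled by the `π`
  -- in front.
  Integral-π⋆recip-! : ∀ n → n < p ℕ.+ p → Integral (π ⋆ recipℕ (n !))
  Integral-π⋆recip-! n n<2p with n ℕ.<? p
  ... | yes n<p = Integral-⋆ (Integral-ℕ p) (Integral-recip-! n n<p)
  ... | no  n≮p = subst (λ m → Integral (π ⋆ recipℕ (m !))) (ℕₚ.m+[n∸m]≡n p≤n)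
    (Integral-π⋆recip-[p+i]! (n ∸ p) (ℕₚ.+-cancelˡ-< p (n ∸ p) p (subst (_< p ℕ.+ p) (sym (ℕₚ.m+[n∸m]≡n p≤n)) n<2p)))
    where p≤n = ℕₚ.≮⇒≥ n≮p

-- Coefficients of the Lucas polynomials at 2 - t

coeff-⊕ : ∀ a b i → coeff (a ⊕ b) i ≡ coeff a i + coeff b i
coeff-⊕ []      b       i       = sym (ℚₚ.+-identityˡ (coeff b i))
coeff-⊕ (x ∷ a) []      i       = sym (ℚₚ.+-identityʳ (coeff (x ∷ a) i))
coeff-⊕ (x ∷ a) (y ∷ b) zero    = refl
coeff-⊕ (x ∷ a) (y ∷ b) (suc i) = coeff-⊕ a b i

coeff-· : ∀ c a i → coeff (c · a) i ≡ c ⋆ coeff a i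
coeff-· c []      i       = sym (ℚₚ.*-zeroʳ c)
coeff-· c (x ∷ a) zero    = refl
coeff-· c (x ∷ a) (suc i) = coeff-· c a i

coeff-⊝ : ∀ a i → coeff (⊝ a) i ≡ - coeff a i
coeff-⊝ a i = trans (coeff-· (- 1ℚ) a i) (solve 1 (λ x → con (- 1ℚ) :* x := :- x) refl (coeff a i))

coeff-⊖ : ∀ a b i → coeff (a ⊖ b) i ≡ coeff a i - coeff b i
coeff-⊖ a b i = trans (coeff-⊕ a (⊝ b) i) (cong (coeff a i +_) (coeff-⊝ b i))

coeff-0∷[] : ∀ i → coeff (0ℚ ∷ []) i ≡ 0ℚ
coeff-0∷[] zero    = refl
coeff-0∷[] (suc i) = refl

-- Stated for coefficients because the lists may differ by a trailing zero, as they do for `a = []`.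
coeff-T⊗ : ∀ a i → coeff (T ⊗ a) i ≡ coeff (0ℚ ∷ a) i
coeff-T⊗ a i = trans (coeff-⊕ (0ℚ · a) (0ℚ ∷ (1ℚ · a ⊕ (0ℚ ∷ []))) i)
  (trans (cong (_+ coeff (0ℚ ∷ (1ℚ · a ⊕ (0ℚ ∷ []))) i) (trans (coeff-· 0ℚ a i) (ℚₚ.*-zeroˡ (coeff a i))))
  (trans (ℚₚ.+-identityˡ _) (shifted i)))
  where
  shifted : ∀ i → coeff (0ℚ ∷ (1ℚ · a ⊕ (0ℚ ∷ []))) i ≡ coeff (0ℚ ∷ a) i
  shifted zero    = refl
  shifted (suc i) = trans (coeff-⊕ (1ℚ · a) (0ℚ ∷ []) i)
    (trans (cong₂ _+_ (trans (coeff-· 1ℚ a i) (ℚₚ.*-identityˡ (coeff a i))) (coeff-0∷[] i)) (ℚₚ.+-identityʳ _))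

coeff-sumP : ∀ n f i → coeff (sumP n f) i ≡ ∑ n (λ k → coeff (f k) i)
coeff-sumP zero    f i = refl
coeff-sumP (suc n) f i = trans (coeff-⊕ (sumP n f) (f (suc n)) i) (cong (_+ coeff (f (suc n)) i) (coeff-sumP n f i))

coeff-T^-≡ : ∀ n → coeff (T^ n) n ≡ 1ℚ
coeff-T^-≡ zero    = refl
coeff-T^-≡ (suc n) = trans (coeff-T⊗ (T^ n) (suc n)) (coeff-T^-≡ n)

coeff-T^-≢ : ∀ n i → n ≢ i → coeff (T^ n) i ≡ 0ℚ
coeff-T^-≢ zero    zero    n≢i = contradiction refl n≢i
coeff-T^-≢ zero    (suc i) n≢i = refl
coeff-T^-≢ (suc n) zero    n≢i = coeff-T⊗ (T^ n) 0
coeff-T^-≢ (suc n) (suc i) n≢i = trans (coeff-T⊗ (T^ n) (suc i)) (coeff-T^-≢ n i (n≢i ∘ cong suc))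

∑-T^-≢ : ∀ n (c : ℕ → ℚ) i → (∀ k → k < n → suc k ≢ i) → ∑ n (λ k → c k ⋆ coeff (T^ k) i) ≡ 0ℚ
∑-T^-≢ n c i i∉ = trans
  (∑-cong n λ k k<n → trans (cong (c (suc k) ⋆_) (coeff-T^-≢ (suc k) i (i∉ k k<n))) (ℚₚ.*-zeroʳ (c (suc k))))
  (∑-0 n)

∑-T^-≡ : ∀ n (c : ℕ → ℚ) i → i < n → ∑ n (λ k → c k ⋆ coeff (T^ k) (suc i)) ≡ c (suc i)
∑-T^-≡ (suc n) c i i<1+n with i ℕ.≟ n
... | yes refl = trans (cong₂ _+_ (∑-T^-≢ n c (suc n) λ k k<n e → ℕₚ.<⇒≢ k<n (ℕₚ.suc-injective e))
                                  (trans (cong (c (suc n) ⋆_) (coeff-T^-≡ (suc n))) (ℚₚ.*-identityʳ (c (suc n)))))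
                       (ℚₚ.+-identityˡ (c (suc n)))
... | no  i≢n  = trans (cong₂ _+_ (∑-T^-≡ n c i (ℕₚ.≤∧≢⇒< (ℕₚ.≤-pred i<1+n) i≢n))
                                  (trans (cong (c (suc n) ⋆_) (coeff-T^-≢ (suc n) (suc i) (i≢n ∘ sym ∘ ℕₚ.suc-injective))) (ℚₚ.*-zeroʳ (c (suc n)))))
                       (ℚₚ.+-identityʳ (c (suc i)))

2ℚ : ℚ
2ℚ = 1ℚ + 1ℚ

sub : Poly → ℕ → ℚ
sub a = coeff (a ∘P twoMinusT)

sub-∷-zero : ∀ x a → sub (x ∷ a) 0 ≡ x + 2ℚ ⋆ sub a 0
sub-∷-zero x a = trans (coeff-⊕ (const x) (twoMinusT ⊗ (a ∘P twoMinusT)) 0) (cong (x +_)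
  (trans (coeff-⊕ (2ℚ · (a ∘P twoMinusT)) (0ℚ ∷ (((- 1ℚ) · (a ∘P twoMinusT)) ⊕ (0ℚ ∷ []))) 0)
  (trans (ℚₚ.+-identityʳ _) (coeff-· 2ℚ (a ∘P twoMinusT) 0))))

sub-∷-suc : ∀ x a i → sub (x ∷ a) (suc i) ≡ 2ℚ ⋆ sub a (suc i) - sub a i
sub-∷-suc x a i = trans (coeff-⊕ (const x) (twoMinusT ⊗ (a ∘P twoMinusT)) (suc i)) (trans (ℚₚ.+-identityˡ _)
  (trans (coeff-⊕ (2ℚ · (a ∘P twoMinusT)) (0ℚ ∷ (((- 1ℚ) · (a ∘P twoMinusT)) ⊕ (0ℚ ∷ []))) (suc i))
  (cong₂ _+_ (coeff-· 2ℚ (a ∘P twoMinusT) (suc i))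
    (trans (coeff-⊕ ((- 1ℚ) · (a ∘P twoMinusT)) (0ℚ ∷ []) i)
    (trans (cong₂ _+_ (coeff-⊝ (a ∘P twoMinusT) i) (coeff-0∷[] i)) (ℚₚ.+-identityʳ _))))))

sub-⊕ : ∀ a b i → sub (a ⊕ b) i ≡ sub a i + sub b i
sub-⊕ []      b       i    = sym (ℚₚ.+-identityˡ (sub b i))
sub-⊕ (x ∷ a) []      i    = sym (ℚₚ.+-identityʳ (sub (x ∷ a) i))
sub-⊕ (x ∷ a) (y ∷ b) zero = begin
  sub ((x + y) ∷ (a ⊕ b)) 0                      ≡⟨ sub-∷-zero (x + y) (a ⊕ b) ⟩
  x + y + 2ℚ ⋆ sub (a ⊕ b) 0                     ≡⟨ cong (λ s → x + y + 2ℚ ⋆ s) (sub-⊕ a b 0) ⟩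
  x + y + 2ℚ ⋆ (sub a 0 + sub b 0)               ≡⟨ solve 4 (λ x y a b → x :+ y :+ con 2ℚ :* (a :+ b) := (x :+ con 2ℚ :* a) :+ (y :+ con 2ℚ :* b)) refl x y (sub a 0) (sub b 0) ⟩
  (x + 2ℚ ⋆ sub a 0) + (y + 2ℚ ⋆ sub b 0)        ≡⟨ cong₂ _+_ (sub-∷-zero x a) (sub-∷-zero y b) ⟨
  sub (x ∷ a) 0 + sub (y ∷ b) 0                  ∎
sub-⊕ (x ∷ a) (y ∷ b) (suc i) = begin
  sub ((x + y) ∷ (a ⊕ b)) (suc i)                               ≡⟨ sub-∷-suc (x + y) (a ⊕ b) i ⟩
  2ℚ ⋆ sub (a ⊕ b) (suc i) - sub (a ⊕ b) i                      ≡⟨ cong₂ (λ s t → 2ℚ ⋆ s - t) (sub-⊕ a b (suc i)) (sub-⊕ a b i) ⟩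
  2ℚ ⋆ (sub a (suc i) + sub b (suc i)) - (sub a i + sub b i)    ≡⟨ solve 4 (λ a b c d → con 2ℚ :* (a :+ b) :- (c :+ d) := (con 2ℚ :* a :- c) :+ (con 2ℚ :* b :- d)) refl (sub a (suc i)) (sub b (suc i)) (sub a i) (sub b i) ⟩
  (2ℚ ⋆ sub a (suc i) - sub a i) + (2ℚ ⋆ sub b (suc i) - sub b i) ≡⟨ cong₂ _+_ (sub-∷-suc x a i) (sub-∷-suc y b i) ⟨
  sub (x ∷ a) (suc i) + sub (y ∷ b) (suc i)                     ∎

sub-⊝ : ∀ a i → sub (⊝ a) i ≡ - sub a i
sub-⊝ []      i    = refl
sub-⊝ (x ∷ a) zero = begin
  sub (⊝ (x ∷ a)) 0                     ≡⟨ sub-∷-zero ((- 1ℚ) ⋆ x) (⊝ a) ⟩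
  (- 1ℚ) ⋆ x + 2ℚ ⋆ sub (⊝ a) 0         ≡⟨ cong (λ s → (- 1ℚ) ⋆ x + 2ℚ ⋆ s) (sub-⊝ a 0) ⟩
  (- 1ℚ) ⋆ x + 2ℚ ⋆ (- sub a 0)         ≡⟨ solve 2 (λ x a → con (- 1ℚ) :* x :+ con 2ℚ :* (:- a) := :- (x :+ con 2ℚ :* a)) refl x (sub a 0) ⟩
  - (x + 2ℚ ⋆ sub a 0)                  ≡⟨ cong -_ (sub-∷-zero x a) ⟨
  - sub (x ∷ a) 0                       ∎
sub-⊝ (x ∷ a) (suc i) = begin
  sub (⊝ (x ∷ a)) (suc i)                       ≡⟨ sub-∷-suc ((- 1ℚ) ⋆ x) (⊝ a) i ⟩
  2ℚ ⋆ sub (⊝ a) (suc i) - sub (⊝ a) i          ≡⟨ cong₂ (λ s t → 2ℚ ⋆ s - t) (sub-⊝ a (suc i)) (sub-⊝ a i) ⟩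
  2ℚ ⋆ (- sub a (suc i)) - (- sub a i)          ≡⟨ solve 2 (λ a b → con 2ℚ :* (:- a) :- (:- b) := :- (con 2ℚ :* a :- b)) refl (sub a (suc i)) (sub a i) ⟩
  - (2ℚ ⋆ sub a (suc i) - sub a i)              ≡⟨ cong -_ (sub-∷-suc x a i) ⟨
  - sub (x ∷ a) (suc i)                         ∎

sub-zero : ∀ a → (∀ i → coeff a i ≡ 0ℚ) → ∀ i → sub a i ≡ 0ℚ
sub-zero []      h i       = refl
sub-zero (x ∷ a) h zero    = trans (sub-∷-zero x a) (cong₂ (λ s t → s + 2ℚ ⋆ t) (h 0) (sub-zero a (h ∘ suc) 0))
sub-zero (x ∷ a) h (suc i) = trans (sub-∷-suc x a i)
  (cong₂ (λ s t → 2ℚ ⋆ s - t) (sub-zero a (h ∘ suc) (suc i)) (sub-zero a (h ∘ suc) i))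

-- Composition recurses on the list, so lists with equal coefficients are not interchangeable by
-- definition. This is what allows `T ⊗ a` to be replaced by `0ℚ ∷ a` inside the Lucas recurrences.
sub-cong : ∀ a b → (∀ i → coeff a i ≡ coeff b i) → ∀ i → sub a i ≡ sub b i
sub-cong []      b       h i       = sym (sub-zero b (sym ∘ h) i)
sub-cong (x ∷ a) []      h i       = sub-zero (x ∷ a) h i
sub-cong (x ∷ a) (y ∷ b) h zero    = trans (sub-∷-zero x a)
  (trans (cong₂ (λ s t → s + 2ℚ ⋆ t) (h 0) (sub-cong a b (h ∘ suc) 0)) (sym (sub-∷-zero y b)))
sub-cong (x ∷ a) (y ∷ b) h (suc i) = trans (sub-∷-suc x a i)
  (trans (cong₂ (λ s t → 2ℚ ⋆ s - t) (sub-cong a b (h ∘ suc) (suc i)) (sub-cong a b (h ∘ suc) i)) (sym (sub-∷-suc y b i)))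

sub-recurrence : ∀ a b i → sub ((T ⊗ a) ⊖ b) i ≡ sub (0ℚ ∷ a) i - sub b i
sub-recurrence a b i = trans (sub-⊕ (T ⊗ a) (⊝ b) i)
  (cong₂ _+_ (sub-cong (T ⊗ a) (0ℚ ∷ a) (coeff-T⊗ a) i) (sub-⊝ b i))

sub-recurrence-zero : ∀ a b → sub ((T ⊗ a) ⊖ b) 0 ≡ 2ℚ ⋆ sub a 0 - sub b 0
sub-recurrence-zero a b = trans (sub-recurrence a b 0)
  (cong (_- sub b 0) (trans (sub-∷-zero 0ℚ a) (ℚₚ.+-identityˡ (2ℚ ⋆ sub a 0))))

sub-recurrence-suc : ∀ a b i → sub ((T ⊗ a) ⊖ b) (suc i) ≡ 2ℚ ⋆ sub a (suc i) - sub a i - sub b (suc i)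
sub-recurrence-suc a b i = trans (sub-recurrence a b (suc i)) (cong (_- sub b (suc i)) (sub-∷-suc 0ℚ a i))

-- u n i and v n i are the coefficients of tⁱ in u_n(2 - t) and v_n(2 - t).
u v : ℕ → ℕ → ℚ
u n = sub (lucasU n)
v n = sub (lucasV n)

-- The central products C_j

ι : ℕ → ℚ
ι zero    = 0ℚ
ι (suc n) = 1ℚ + ι n

-- `ι` is the embedding by recursion: `ι (suc n)` unfolds to `1ℚ + ι n`, the form in which the ring
-- identities below are written.
ι≡ℕ→ℚ : ∀ n → ι n ≡ ℕ→ℚ n
ι≡ℕ→ℚ zero    = refl
ι≡ℕ→ℚ (suc n) = trans (cong (1ℚ +_) (ι≡ℕ→ℚ n)) (sym (ℕ→ℚ-suc n))

-- The cofactor C_j(x) / x as a polynomial in y = x². It is separate from `central` because both S_j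
-- and the expansion at p concern this quotient.
squares : ℕ → ℚ → ℚ
squares zero    y = 1ℚ
squares (suc j) y = (ι (suc j) ⋆ ι (suc j) - y) ⋆ squares j y

-- (-1)^j (x - j)(x - j + 1)⋯(x + j)
central : ℕ → ℚ → ℚ
central j x = x ⋆ squares j (x ⋆ x)

-- This is (2j+1)!, with the two new factors in the shape in which the second difference of
-- `central` produces them.
oddFactorial : ℕ → ℚ
oddFactorial zero    = 1ℚ
oddFactorial (suc j) = (2ℚ ⋆ ι j + 2ℚ) ⋆ (2ℚ ⋆ ι j + 2ℚ + 1ℚ) ⋆ oddFactorial j

central-suc : ∀ j x → central (suc j) x ≡ ((1ℚ + ι j) ⋆ (1ℚ + ι j) - x ⋆ x) ⋆ central j x
central-suc j x = solve 3 (λ J x q → x :* (((con 1ℚ :+ J) :* (con 1ℚ :+ J) :- x :* x) :* q) := ((con 1ℚ :+ J) :* (con 1ℚ :+ J) :- x :* x) :* (x :* q)) refl (ι j) x (squares j (x ⋆ x))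

-- Up to the same sign, both sides are the product of the 2j + 2 consecutive factors x - j, ..., x +
-- j + 1.
central-shift : ∀ j x → (1ℚ + x + ι j) ⋆ central j x ≡ (x - ι j) ⋆ central j (1ℚ + x)
central-shift zero x = solve 1 (λ x → (con 1ℚ :+ x :+ con 0ℚ) :* (x :* con 1ℚ) := (x :- con 0ℚ) :* ((con 1ℚ :+ x) :* con 1ℚ)) refl x
central-shift (suc j) x = begin
  (1ℚ + x + (1ℚ + J)) ⋆ central (suc j) x
    ≡⟨ cong ((1ℚ + x + (1ℚ + J)) ⋆_) (central-suc j x) ⟩
  (1ℚ + x + (1ℚ + J)) ⋆ (((1ℚ + J) ⋆ (1ℚ + J) - x ⋆ x) ⋆ central j x)
    ≡⟨ solve 3 (λ J x a → (con 1ℚ :+ x :+ (con 1ℚ :+ J)) :* (((con 1ℚ :+ J) :* (con 1ℚ :+ J) :- x :* x) :* a)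
         := (con 1ℚ :+ x :+ (con 1ℚ :+ J)) :* (con 1ℚ :+ J :- x) :* ((con 1ℚ :+ x :+ J) :* a)) refl J x (central j x) ⟩
  (1ℚ + x + (1ℚ + J)) ⋆ (1ℚ + J - x) ⋆ ((1ℚ + x + J) ⋆ central j x)
    ≡⟨ cong ((1ℚ + x + (1ℚ + J)) ⋆ (1ℚ + J - x) ⋆_) (central-shift j x) ⟩
  (1ℚ + x + (1ℚ + J)) ⋆ (1ℚ + J - x) ⋆ ((x - J) ⋆ central j (1ℚ + x))
    ≡⟨ solve 3 (λ J x a → (con 1ℚ :+ x :+ (con 1ℚ :+ J)) :* (con 1ℚ :+ J :- x) :* ((x :- J) :* a)
         := (x :- (con 1ℚ :+ J)) :* (((con 1ℚ :+ J) :* (con 1ℚ :+ J) :- (con 1ℚ :+ x) :* (con 1ℚ :+ x)) :* a)) refl J x (central j (1ℚ + x)) ⟩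
  (x - (1ℚ + J)) ⋆ (((1ℚ + J) ⋆ (1ℚ + J) - (1ℚ + x) ⋆ (1ℚ + x)) ⋆ central j (1ℚ + x))
    ≡⟨ cong ((x - (1ℚ + J)) ⋆_) (central-suc j (1ℚ + x)) ⟨
  (x - (1ℚ + J)) ⋆ central (suc j) (1ℚ + x)
    ∎
  where J = ι j

central-up : ∀ j x → central (suc j) (1ℚ + x) ≡ - ((1ℚ + x + (1ℚ + ι j)) ⋆ ((1ℚ + x + ι j) ⋆ central j x))
central-up j x = begin
  central (suc j) (1ℚ + x)
    ≡⟨ central-suc j (1ℚ + x) ⟩
  ((1ℚ + J) ⋆ (1ℚ + J) - (1ℚ + x) ⋆ (1ℚ + x)) ⋆ central j (1ℚ + x)
    ≡⟨ solve 3 (λ J x a → ((con 1ℚ :+ J) :* (con 1ℚ :+ J) :- (con 1ℚ :+ x) :* (con 1ℚ :+ x)) :* a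
         := :- ((con 1ℚ :+ x :+ (con 1ℚ :+ J)) :* ((x :- J) :* a))) refl J x (central j (1ℚ + x)) ⟩
  - ((1ℚ + x + (1ℚ + J)) ⋆ ((x - J) ⋆ central j (1ℚ + x)))
    ≡⟨ cong (λ s → - ((1ℚ + x + (1ℚ + J)) ⋆ s)) (central-shift j x) ⟨
  - ((1ℚ + x + (1ℚ + J)) ⋆ ((1ℚ + x + J) ⋆ central j x))
    ∎
  where J = ι j

central-down : ∀ j x → central (suc j) x ≡ (1ℚ + ι j - x) ⋆ ((x - ι j) ⋆ central j (1ℚ + x))
central-down j x = begin
  central (suc j) x
    ≡⟨ central-suc j x ⟩
  ((1ℚ + J) ⋆ (1ℚ + J) - x ⋆ x) ⋆ central j x
    ≡⟨ solve 3 (λ J x a → ((con 1ℚ :+ J) :* (con 1ℚ :+ J) :- x :* x) :* a := (con 1ℚ :+ J :- x) :* ((con 1ℚ :+ x :+ J) :* a)) refl J x (central j x) ⟩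
  (1ℚ + J - x) ⋆ ((1ℚ + x + J) ⋆ central j x)
    ≡⟨ cong ((1ℚ + J - x) ⋆_) (central-shift j x) ⟩
  (1ℚ + J - x) ⋆ ((x - J) ⋆ central j (1ℚ + x))
    ∎
  where J = ι j

central-at-0 : ∀ j → central j 0ℚ ≡ 0ℚ
central-at-0 j = ℚₚ.*-zeroˡ (squares j 0ℚ)

central-vanish : ∀ n j → n ≤ j → central j (ι n) ≡ 0ℚ
central-vanish zero    j       _         = central-at-0 j
central-vanish (suc n) (suc j) (s≤s n≤j) = trans (central-up j (ι n)) (trans
  (cong (λ s → - ((1ℚ + ι n + (1ℚ + ι j)) ⋆ ((1ℚ + ι n + ι j) ⋆ s))) (central-vanish n j n≤j))
  (solve 2 (λ a b → :- (a :* (b :* con 0ℚ)) := con 0ℚ) refl (1ℚ + ι n + (1ℚ + ι j)) (1ℚ + ι n + ι j)))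

-1^ : ℕ → ℚ
-1^ zero    = 1ℚ
-1^ (suc j) = - -1^ j

-- At x = j + 1 the consecutive factors are 1, 2, ..., 2j + 1. This becomes the leading coefficient
-- of u_{j+1}(2 - t).
central-top : ∀ j → central j (ι (suc j)) ≡ -1^ j ⋆ oddFactorial j
central-top zero    = refl
central-top (suc j) = trans (central-up j (ι (suc j))) (trans
  (cong (λ s → - ((1ℚ + (1ℚ + ι j) + (1ℚ + ι j)) ⋆ ((1ℚ + (1ℚ + ι j) + ι j) ⋆ s))) (central-top j))
  (solve 3 (λ J s o → :- ((con 1ℚ :+ (con 1ℚ :+ J) :+ (con 1ℚ :+ J)) :* ((con 1ℚ :+ (con 1ℚ :+ J) :+ J) :* (s :* o)))
    := :- s :* ((con 2ℚ :* J :+ con 2ℚ) :* (con 2ℚ :* J :+ con 2ℚ :+ con 1ℚ) :* o)) refl (ι j) (-1^ j) (oddFactorial j)))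

-- Let D(m) = (m + 1 + j) C_j(m). By `central-shift`, D(m - 1) = (m - 1 - j) C_j(m), hence D(m) -
-- D(m - 1) = (2j + 2) C_j(m), and D(0) = 0.
∑-central : ∀ j n → (2ℚ ⋆ ι j + 2ℚ) ⋆ ∑ n (λ m → central j (ι m)) ≡ (1ℚ + ι n + ι j) ⋆ central j (ι n)
∑-central j zero = trans (ℚₚ.*-zeroʳ (2ℚ ⋆ ι j + 2ℚ)) (sym (trans (cong ((1ℚ + 0ℚ + ι j) ⋆_) (central-at-0 j)) (ℚₚ.*-zeroʳ (1ℚ + 0ℚ + ι j))))
∑-central j (suc n) = begin
  (2ℚ ⋆ J + 2ℚ) ⋆ (S + c)                 ≡⟨ ℚₚ.*-distribˡ-+ (2ℚ ⋆ J + 2ℚ) S c ⟩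
  (2ℚ ⋆ J + 2ℚ) ⋆ S + (2ℚ ⋆ J + 2ℚ) ⋆ c   ≡⟨ cong (_+ (2ℚ ⋆ J + 2ℚ) ⋆ c) (trans (∑-central j n) (central-shift j (ι n))) ⟩
  (ι n - J) ⋆ c + (2ℚ ⋆ J + 2ℚ) ⋆ c       ≡⟨ solve 3 (λ J n c → (n :- J) :* c :+ (con 2ℚ :* J :+ con 2ℚ) :* c := (con 1ℚ :+ (con 1ℚ :+ n) :+ J) :* c) refl J (ι n) c ⟩
  (1ℚ + (1ℚ + ι n) + J) ⋆ c               ∎
  where
  J = ι j
  S = ∑ n (λ m → central j (ι m))
  c = central j (1ℚ + ι n)

-- The values of `central (suc j)` at x + 2, x + 1 and x are all multiples of `central j (1ℚ + x)`,
-- by `central-up`, `central-suc` and `central-down`; comparing the cofactors is a polynomial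
-- identity. It is the recurrence of u_n(2 - t), read at t^(j+1) and scaled by (2j+3)!.
central-secondDifference : ∀ j x → central (suc j) (1ℚ + (1ℚ + x))
  ≡ 2ℚ ⋆ central (suc j) (1ℚ + x) - (2ℚ ⋆ ι j + 2ℚ) ⋆ (2ℚ ⋆ ι j + 2ℚ + 1ℚ) ⋆ central j (1ℚ + x) - central (suc j) x
central-secondDifference j x = trans (central-up j (1ℚ + x)) (trans
  (solve 3 (λ J x c → :- ((con 1ℚ :+ (con 1ℚ :+ x) :+ (con 1ℚ :+ J)) :* ((con 1ℚ :+ (con 1ℚ :+ x) :+ J) :* c))
    := con 2ℚ :* (((con 1ℚ :+ J) :* (con 1ℚ :+ J) :- (con 1ℚ :+ x) :* (con 1ℚ :+ x)) :* c)
       :- (con 2ℚ :* J :+ con 2ℚ) :* (con 2ℚ :* J :+ con 2ℚ :+ con 1ℚ) :* c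
       :- (con 1ℚ :+ J :- x) :* ((x :- J) :* c)) refl (ι j) x (central j (1ℚ + x)))
  (cong₂ (λ s t → 2ℚ ⋆ s - (2ℚ ⋆ ι j + 2ℚ) ⋆ (2ℚ ⋆ ι j + 2ℚ + 1ℚ) ⋆ central j (1ℚ + x) - t)
    (sym (central-suc j (1ℚ + x))) (sym (central-down j x))))

-- The analogue for v_n. The constant 2 (j+2) (2j+3) is the ratio of (j+2) (2j+3)! to (j+1) (2j+1)!,
-- the consecutive scalings in `oddFactorial⋆v`.
x⋆central-secondDifference : ∀ j x → (1ℚ + (1ℚ + x)) ⋆ central (suc j) (1ℚ + (1ℚ + x))
  ≡ 2ℚ ⋆ ((1ℚ + x) ⋆ central (suc j) (1ℚ + x)) - 2ℚ ⋆ (2ℚ + ι j) ⋆ (2ℚ ⋆ ι j + 2ℚ + 1ℚ) ⋆ ((1ℚ + x) ⋆ central j (1ℚ + x)) - x ⋆ central (suc j) x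
x⋆central-secondDifference j x = trans (cong ((1ℚ + (1ℚ + x)) ⋆_) (central-up j (1ℚ + x))) (trans
  (solve 3 (λ J x c → (con 1ℚ :+ (con 1ℚ :+ x)) :* (:- ((con 1ℚ :+ (con 1ℚ :+ x) :+ (con 1ℚ :+ J)) :* ((con 1ℚ :+ (con 1ℚ :+ x) :+ J) :* c)))
    := con 2ℚ :* ((con 1ℚ :+ x) :* (((con 1ℚ :+ J) :* (con 1ℚ :+ J) :- (con 1ℚ :+ x) :* (con 1ℚ :+ x)) :* c))
       :- con 2ℚ :* (con 2ℚ :+ J) :* (con 2ℚ :* J :+ con 2ℚ :+ con 1ℚ) :* ((con 1ℚ :+ x) :* c)
       :- x :* ((con 1ℚ :+ J :- x) :* ((x :- J) :* c))) refl (ι j) x (central j (1ℚ + x)))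
  (cong₂ (λ s t → 2ℚ ⋆ ((1ℚ + x) ⋆ s) - 2ℚ ⋆ (2ℚ + ι j) ⋆ (2ℚ ⋆ ι j + 2ℚ + 1ℚ) ⋆ ((1ℚ + x) ⋆ central j (1ℚ + x)) - x ⋆ t)
    (sym (central-suc j (1ℚ + x))) (sym (central-down j x))))

-- Closed forms for the coefficients of u_n(2 - t) and v_n(2 - t)

u-1-suc : ∀ j → u 1 (suc j) ≡ 0ℚ
u-1-suc zero    = refl
u-1-suc (suc j) = refl

v-0-suc : ∀ j → v 0 (suc j) ≡ 0ℚ
v-0-suc zero    = refl
v-0-suc (suc j) = refl

v-1-suc-suc : ∀ j → v 1 (suc (suc j)) ≡ 0ℚ
v-1-suc-suc zero    = refl
v-1-suc-suc (suc j) = refl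

v-zero : ∀ n → v n 0 ≡ 2ℚ
v-zero zero          = refl
v-zero (suc zero)    = refl
v-zero (suc (suc n)) = trans (sub-recurrence-zero (lucasV (suc n)) (lucasV n))
  (cong₂ (λ s t → 2ℚ ⋆ s - t) (v-zero (suc n)) (v-zero n))

-- Both sides obey the same two-step recurrence in n. Scaling by (2j+1)! keeps the induction free of
-- division.
oddFactorial⋆u : ∀ n j → oddFactorial j ⋆ u n j ≡ central j (ι n)
oddFactorial⋆u zero j = trans (ℚₚ.*-zeroʳ (oddFactorial j)) (sym (central-at-0 j))
oddFactorial⋆u (suc zero) zero = refl
oddFactorial⋆u (suc zero) (suc j) = trans (cong (oddFactorial (suc j) ⋆_) (u-1-suc j))
  (trans (ℚₚ.*-zeroʳ (oddFactorial (suc j))) (sym (central-vanish 1 (suc j) (s≤s z≤n))))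
oddFactorial⋆u (suc (suc n)) zero = begin
  1ℚ ⋆ u (suc (suc n)) 0                     ≡⟨ cong (1ℚ ⋆_) (sub-recurrence-zero (lucasU (suc n)) (lucasU n)) ⟩
  1ℚ ⋆ (2ℚ ⋆ u (suc n) 0 - u n 0)            ≡⟨ solve 2 (λ a b → con 1ℚ :* (con 2ℚ :* a :- b) := con 2ℚ :* (con 1ℚ :* a) :- con 1ℚ :* b) refl (u (suc n) 0) (u n 0) ⟩
  2ℚ ⋆ (1ℚ ⋆ u (suc n) 0) - 1ℚ ⋆ u n 0       ≡⟨ cong₂ (λ s t → 2ℚ ⋆ s - t) (oddFactorial⋆u (suc n) 0) (oddFactorial⋆u n 0) ⟩
  2ℚ ⋆ ((1ℚ + ι n) ⋆ 1ℚ) - ι n ⋆ 1ℚ          ≡⟨ solve 1 (λ n → con 2ℚ :* ((con 1ℚ :+ n) :* con 1ℚ) :- n :* con 1ℚ := (con 1ℚ :+ (con 1ℚ :+ n)) :* con 1ℚ) refl (ι n) ⟩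
  (1ℚ + (1ℚ + ι n)) ⋆ 1ℚ                     ∎
oddFactorial⋆u (suc (suc n)) (suc j) = begin
  c ⋆ o ⋆ u (suc (suc n)) (suc j)
    ≡⟨ cong (c ⋆ o ⋆_) (sub-recurrence-suc (lucasU (suc n)) (lucasU n) j) ⟩
  c ⋆ o ⋆ (2ℚ ⋆ u (suc n) (suc j) - u (suc n) j - u n (suc j))
    ≡⟨ solve 5 (λ c o a b d → c :* o :* (con 2ℚ :* a :- b :- d) := con 2ℚ :* (c :* o :* a) :- c :* (o :* b) :- c :* o :* d) refl c o (u (suc n) (suc j)) (u (suc n) j) (u n (suc j)) ⟩
  2ℚ ⋆ (c ⋆ o ⋆ u (suc n) (suc j)) - c ⋆ (o ⋆ u (suc n) j) - c ⋆ o ⋆ u n (suc j)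
    ≡⟨ cong₂ _-_ (cong₂ (λ s t → 2ℚ ⋆ s - c ⋆ t) (oddFactorial⋆u (suc n) (suc j)) (oddFactorial⋆u (suc n) j)) (oddFactorial⋆u n (suc j)) ⟩
  2ℚ ⋆ central (suc j) (1ℚ + ι n) - c ⋆ central j (1ℚ + ι n) - central (suc j) (ι n)
    ≡⟨ central-secondDifference j (ι n) ⟨
  central (suc j) (1ℚ + (1ℚ + ι n))
    ∎
  where
  c = (2ℚ ⋆ ι j + 2ℚ) ⋆ (2ℚ ⋆ ι j + 2ℚ + 1ℚ)
  o = oddFactorial j

oddFactorial⋆v : ∀ n j → (1ℚ + ι j) ⋆ oddFactorial j ⋆ v n (suc j) ≡ - (ι n ⋆ central j (ι n))
oddFactorial⋆v zero j = trans (cong ((1ℚ + ι j) ⋆ oddFactorial j ⋆_) (v-0-suc j))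
  (solve 2 (λ a c → a :* con 0ℚ := :- (con 0ℚ :* c)) refl ((1ℚ + ι j) ⋆ oddFactorial j) (central j 0ℚ))
oddFactorial⋆v (suc zero) zero = refl
oddFactorial⋆v (suc zero) (suc j) = trans (cong ((1ℚ + ι (suc j)) ⋆ oddFactorial (suc j) ⋆_) (v-1-suc-suc j))
  (trans (ℚₚ.*-zeroʳ ((1ℚ + ι (suc j)) ⋆ oddFactorial (suc j))) (cong (λ s → - (1ℚ ⋆ s)) (sym (central-vanish 1 (suc j) (s≤s z≤n)))))
oddFactorial⋆v (suc (suc n)) zero = begin
  1ℚ ⋆ v (suc (suc n)) 1
    ≡⟨ cong (1ℚ ⋆_) (sub-recurrence-suc (lucasV (suc n)) (lucasV n) 0) ⟩
  1ℚ ⋆ (2ℚ ⋆ v (suc n) 1 - v (suc n) 0 - v n 1)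
    ≡⟨ solve 3 (λ a b c → con 1ℚ :* (con 2ℚ :* a :- b :- c) := con 2ℚ :* (con 1ℚ :* a) :- b :- con 1ℚ :* c) refl (v (suc n) 1) (v (suc n) 0) (v n 1) ⟩
  2ℚ ⋆ (1ℚ ⋆ v (suc n) 1) - v (suc n) 0 - 1ℚ ⋆ v n 1
    -- Multiplication by -t brings in the constant coefficient, which the claim does not cover: it
    -- is v_n(2) = 2 for every n.
    ≡⟨ cong₂ _-_ (cong₂ (λ s t → 2ℚ ⋆ s - t) (oddFactorial⋆v (suc n) 0) (v-zero (suc n))) (oddFactorial⋆v n 0) ⟩
  2ℚ ⋆ (- ((1ℚ + ι n) ⋆ ((1ℚ + ι n) ⋆ 1ℚ))) - 2ℚ - (- (ι n ⋆ (ι n ⋆ 1ℚ)))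
    ≡⟨ solve 1 (λ n → con 2ℚ :* (:- ((con 1ℚ :+ n) :* ((con 1ℚ :+ n) :* con 1ℚ))) :- con 2ℚ :- (:- (n :* (n :* con 1ℚ)))
         := :- ((con 1ℚ :+ (con 1ℚ :+ n)) :* ((con 1ℚ :+ (con 1ℚ :+ n)) :* con 1ℚ))) refl (ι n) ⟩
  - ((1ℚ + (1ℚ + ι n)) ⋆ ((1ℚ + (1ℚ + ι n)) ⋆ 1ℚ))
    ∎
oddFactorial⋆v (suc (suc n)) (suc j) = begin
  (1ℚ + (1ℚ + J)) ⋆ (a ⋆ b ⋆ o) ⋆ v (suc (suc n)) (suc (suc j))
    ≡⟨ cong ((1ℚ + (1ℚ + J)) ⋆ (a ⋆ b ⋆ o) ⋆_) (sub-recurrence-suc (lucasV (suc n)) (lucasV n) (suc j)) ⟩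
  (1ℚ + (1ℚ + J)) ⋆ (a ⋆ b ⋆ o) ⋆ (2ℚ ⋆ v (suc n) (suc (suc j)) - v (suc n) (suc j) - v n (suc (suc j)))
    ≡⟨ solve 5 (λ J o x y z → let a = con 2ℚ :* J :+ con 2ℚ; b = con 2ℚ :* J :+ con 2ℚ :+ con 1ℚ; k = con 1ℚ :+ (con 1ℚ :+ J) in
         k :* (a :* b :* o) :* (con 2ℚ :* x :- y :- z)
         := con 2ℚ :* (k :* (a :* b :* o) :* x) :- con 2ℚ :* (con 2ℚ :+ J) :* b :* ((con 1ℚ :+ J) :* o :* y) :- k :* (a :* b :* o) :* z)
       refl J o (v (suc n) (suc (suc j))) (v (suc n) (suc j)) (v n (suc (suc j))) ⟩
  2ℚ ⋆ ((1ℚ + (1ℚ + J)) ⋆ (a ⋆ b ⋆ o) ⋆ v (suc n) (suc (suc j))) - 2ℚ ⋆ (2ℚ + J) ⋆ b ⋆ ((1ℚ + J) ⋆ o ⋆ v (suc n) (suc j)) - (1ℚ + (1ℚ + J)) ⋆ (a ⋆ b ⋆ o) ⋆ v n (suc (suc j))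
    ≡⟨ cong₂ _-_ (cong₂ (λ s t → 2ℚ ⋆ s - 2ℚ ⋆ (2ℚ + J) ⋆ b ⋆ t) (oddFactorial⋆v (suc n) (suc j)) (oddFactorial⋆v (suc n) j)) (oddFactorial⋆v n (suc j)) ⟩
  2ℚ ⋆ (- ((1ℚ + ι n) ⋆ c₁)) - 2ℚ ⋆ (2ℚ + J) ⋆ b ⋆ (- ((1ℚ + ι n) ⋆ c)) - (- (ι n ⋆ c₀))
    ≡⟨ solve 4 (λ x k y z → con 2ℚ :* (:- x) :- k :* (:- y) :- (:- z) := :- (con 2ℚ :* x :- k :* y :- z)) refl ((1ℚ + ι n) ⋆ c₁) (2ℚ ⋆ (2ℚ + J) ⋆ b) ((1ℚ + ι n) ⋆ c) (ι n ⋆ c₀) ⟩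
  - (2ℚ ⋆ ((1ℚ + ι n) ⋆ c₁) - 2ℚ ⋆ (2ℚ + J) ⋆ b ⋆ ((1ℚ + ι n) ⋆ c) - ι n ⋆ c₀)
    ≡⟨ cong -_ (x⋆central-secondDifference j (ι n)) ⟨
  - ((1ℚ + (1ℚ + ι n)) ⋆ central (suc j) (1ℚ + (1ℚ + ι n)))
    ∎
  where
  J = ι j
  a = 2ℚ ⋆ J + 2ℚ
  b = 2ℚ ⋆ J + 2ℚ + 1ℚ
  o = oddFactorial j
  c = central j (1ℚ + ι n)
  c₁ = central (suc j) (1ℚ + ι n)
  c₀ = central (suc j) (ι n)

½ : ℚ
½ = recipℕ 2

recipℕ⋆ι : ∀ n → recipℕ (suc n) ⋆ ι (suc n) ≡ 1ℚ
recipℕ⋆ι n = trans (cong (recipℕ (suc n) ⋆_) (ι≡ℕ→ℚ (suc n))) (recipℕ-inverse (suc n))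

fact : ℕ → ℚ
fact n = ℕ→ℚ (n !)

fact-suc : ∀ n → fact (suc n) ≡ (1ℚ + ι n) ⋆ fact n
fact-suc n = trans (ℕ→ℚ-* (suc n) (n !)) (cong (_⋆ fact n) (sym (ι≡ℕ→ℚ (suc n))))

oddFactorial≡ : ∀ j → oddFactorial j ≡ fact (suc (j ℕ.+ j))
oddFactorial≡ zero    = refl
oddFactorial≡ (suc j) = begin
  (2ℚ ⋆ ι j + 2ℚ) ⋆ (2ℚ ⋆ ι j + 2ℚ + 1ℚ) ⋆ oddFactorial j
    ≡⟨ cong ((2ℚ ⋆ ι j + 2ℚ) ⋆ (2ℚ ⋆ ι j + 2ℚ + 1ℚ) ⋆_) (oddFactorial≡ j) ⟩
  (2ℚ ⋆ ι j + 2ℚ) ⋆ (2ℚ ⋆ ι j + 2ℚ + 1ℚ) ⋆ f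
    ≡⟨ solve 2 (λ J f → (con 2ℚ :* J :+ con 2ℚ) :* (con 2ℚ :* J :+ con 2ℚ :+ con 1ℚ) :* f
         := (con 1ℚ :+ (con 1ℚ :+ (con 1ℚ :+ (J :+ J)))) :* ((con 1ℚ :+ (con 1ℚ :+ (J :+ J))) :* f)) refl (ι j) f ⟩
  (1ℚ + (1ℚ + (1ℚ + (ι j + ι j)))) ⋆ ((1ℚ + (1ℚ + (ι j + ι j))) ⋆ f)
    ≡⟨ cong (λ s → (1ℚ + (1ℚ + (1ℚ + s))) ⋆ ((1ℚ + (1ℚ + s)) ⋆ f)) ι-double ⟩
  (1ℚ + ι (suc (suc (j ℕ.+ j)))) ⋆ ((1ℚ + ι (suc (j ℕ.+ j))) ⋆ f)
    ≡⟨ cong ((1ℚ + ι (suc (suc (j ℕ.+ j)))) ⋆_) (fact-suc (suc (j ℕ.+ j))) ⟨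
  (1ℚ + ι (suc (suc (j ℕ.+ j)))) ⋆ fact (suc (suc (j ℕ.+ j)))
    ≡⟨ fact-suc (suc (suc (j ℕ.+ j))) ⟨
  fact (suc (suc (suc (j ℕ.+ j))))
    ≡⟨ cong (fact ∘ suc ∘ suc) (ℕₚ.+-suc j j) ⟨
  fact (suc (suc j ℕ.+ suc j))
    ∎
  where
  f = fact (suc (j ℕ.+ j))
  ι-double : ι j + ι j ≡ ι (j ℕ.+ j)
  ι-double = trans (cong₂ _+_ (ι≡ℕ→ℚ j) (ι≡ℕ→ℚ j)) (trans (sym (ℕ→ℚ-+ j j)) (sym (ι≡ℕ→ℚ (j ℕ.+ j))))

r : ℕ → ℚ
r j = recipℕ (suc (j ℕ.+ j) !)

r⋆oddFactorial : ∀ j → r j ⋆ oddFactorial j ≡ 1ℚ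
r⋆oddFactorial j = trans (cong (r j ⋆_) (oddFactorial≡ j)) (recipℕ-inverse (suc (j ℕ.+ j) !) {{suc (j ℕ.+ j) !≢0}})

u≡ : ∀ n j → u n j ≡ r j ⋆ central j (ι n)
u≡ n j = begin
  u n j                              ≡⟨ ℚₚ.*-identityˡ (u n j) ⟨
  1ℚ ⋆ u n j                         ≡⟨ cong (_⋆ u n j) (r⋆oddFactorial j) ⟨
  r j ⋆ oddFactorial j ⋆ u n j       ≡⟨ ℚₚ.*-assoc (r j) (oddFactorial j) (u n j) ⟩
  r j ⋆ (oddFactorial j ⋆ u n j)     ≡⟨ cong (r j ⋆_) (oddFactorial⋆u n j) ⟩
  r j ⋆ central j (ι n)              ∎

u-vanish : ∀ n j → n ≤ j → u n j ≡ 0ℚ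
u-vanish n j n≤j = trans (u≡ n j) (trans (cong (r j ⋆_) (central-vanish n j n≤j)) (ℚₚ.*-zeroʳ (r j)))

u-top : ∀ j → u (suc j) j ≡ -1^ j
u-top j = begin
  u (suc j) j                           ≡⟨ u≡ (suc j) j ⟩
  r j ⋆ central j (ι (suc j))           ≡⟨ cong (r j ⋆_) (central-top j) ⟩
  r j ⋆ (-1^ j ⋆ oddFactorial j)        ≡⟨ solve 3 (λ r s o → r :* (s :* o) := s :* (r :* o)) refl (r j) (-1^ j) (oddFactorial j) ⟩
  -1^ j ⋆ (r j ⋆ oddFactorial j)        ≡⟨ cong (-1^ j ⋆_) (r⋆oddFactorial j) ⟩
  -1^ j ⋆ 1ℚ                            ≡⟨ ℚₚ.*-identityʳ (-1^ j) ⟩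
  -1^ j                                 ∎

-1^-even : ∀ h → -1^ (h ℕ.+ h) ≡ 1ℚ
-1^-even zero    = refl
-1^-even (suc h) = trans (cong (λ k → - -1^ k) (ℕₚ.+-suc h h)) (trans (solve 1 (λ x → :- (:- x) := x) refl (-1^ (h ℕ.+ h))) (-1^-even h))

v≡ : ∀ n j → v n (suc j) ≡ - (recipℕ (suc j) ⋆ (ι n ⋆ u n j))
v≡ n j = begin
  v n (suc j)
    ≡⟨ solve 1 (λ v → v := con 1ℚ :* con 1ℚ :* v) refl (v n (suc j)) ⟩
  1ℚ ⋆ 1ℚ ⋆ v n (suc j)
    ≡⟨ cong₂ (λ s t → s ⋆ t ⋆ v n (suc j)) (recipℕ⋆ι j) (r⋆oddFactorial j) ⟨
  (ρ ⋆ (1ℚ + ι j)) ⋆ (r j ⋆ oddFactorial j) ⋆ v n (suc j)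
    ≡⟨ solve 5 (λ ρ k r o v → (ρ :* k) :* (r :* o) :* v := ρ :* (r :* (k :* o :* v))) refl ρ (1ℚ + ι j) (r j) (oddFactorial j) (v n (suc j)) ⟩
  ρ ⋆ (r j ⋆ ((1ℚ + ι j) ⋆ oddFactorial j ⋆ v n (suc j)))
    ≡⟨ cong (λ s → ρ ⋆ (r j ⋆ s)) (oddFactorial⋆v n j) ⟩
  ρ ⋆ (r j ⋆ (- (ι n ⋆ central j (ι n))))
    ≡⟨ solve 4 (λ ρ r n c → ρ :* (r :* (:- (n :* c))) := :- (ρ :* (n :* (r :* c)))) refl ρ (r j) (ι n) (central j (ι n)) ⟩
  - (ρ ⋆ (ι n ⋆ (r j ⋆ central j (ι n))))
    ≡⟨ cong (λ s → - (ρ ⋆ (ι n ⋆ s))) (u≡ n j) ⟨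
  - (ρ ⋆ (ι n ⋆ u n j))
    ∎
  where ρ = recipℕ (suc j)

-- Central binomial coefficients

C*k!*k! : ∀ k → ((2 * k) C k) * (k ! * k !) ≡ (2 * k) !
C*k!*k! k = begin
  ((2 * k) C k) * (k ! * k !)
    ≡⟨ cong (λ m → ((2 * k) C k) * (k ! * m !)) 2k∸k ⟨
  ((2 * k) C k) * (k ! * (2 * k ∸ k) !)
    ≡⟨ cong (_* (k ! * (2 * k ∸ k) !)) (nCk≡n!/k![n-k]! k≤2k) ⟩
  ((2 * k) ! ℕ./ (k ! * (2 * k ∸ k) !)) * (k ! * (2 * k ∸ k) !)
    ≡⟨ m/n*n≡m (subst (_∣ (2 * k) !) (ℕₚ.*-comm ((2 * k ∸ k) !) (k !)) ([n∸k]!k!∣n! k≤2k)) ⟩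
  (2 * k) !
    ∎
  where
  instance _ = k !* (2 * k ∸ k) !≢0
  k≤2k : k ≤ 2 * k
  k≤2k = ℕₚ.m≤m+n k (k ℕ.+ 0)
  2k∸k : 2 * k ∸ k ≡ k
  2k∸k = trans (ℕₚ.m+n∸m≡n k (k ℕ.+ 0)) (ℕₚ.+-identityʳ k)

C-nonZero : ∀ k → ℕ.NonZero ((2 * k) C k)
C-nonZero k = ℕ.≢-nonZero λ C≡0 → ℕ.≢-nonZero⁻¹ ((2 * k) !) {{(2 * k) !≢0}} (trans (sym (C*k!*k! k)) (cong (_* (k ! * k !)) C≡0))

-- After multiplication by `suc j` both sides are (2j+2)!: on the left the two factors `suc j` turn
-- j!² into (j+1)!², on the right 2 (j+1) (2j+1)! appears.
[1+j]C : ∀ j → suc j * ((2 * suc j) C suc j) * (j ! * j !) ≡ 2 * suc (j ℕ.+ j) !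
[1+j]C j = ℕₚ.*-cancelˡ-≡ _ _ (suc j) (begin
  suc j * (suc j * c * (j ! * j !))    ≡⟨ ℕ-solve 3 (λ k c f → k ⊛ (k ⊛ c ⊛ (f ⊛ f)) ⊜ c ⊛ ((k ⊛ f) ⊛ (k ⊛ f))) refl (suc j) c (j !) ⟩
  c * (suc j ! * suc j !)              ≡⟨ C*k!*k! (suc j) ⟩
  (2 * suc j) !                        ≡⟨ cong _! 2*suc ⟩
  suc (suc (j ℕ.+ j)) * g              ≡⟨ cong (_* g) (trans (sym 2*suc) (ℕₚ.*-comm 2 (suc j))) ⟩
  suc j * 2 * g                        ≡⟨ ℕₚ.*-assoc (suc j) 2 g ⟩
  suc j * (2 * g)                      ∎)
  where
  c = (2 * suc j) C suc j
  g = suc (j ℕ.+ j) !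
  2*suc : 2 * suc j ≡ suc (suc (j ℕ.+ j))
  2*suc = cong suc (trans (cong (j ℕ.+_) (ℕₚ.+-identityʳ (suc j))) (ℕₚ.+-suc j j))

recip-kC : ∀ j → recipℕ (suc j * ((2 * suc j) C suc j)) ≡ ½ ⋆ (fact j ⋆ fact j) ⋆ r j
recip-kC j = sym (trans (recipℕ-unique N {{N≢0}} {y = 1ℚ} (begin
  ℕ→ℚ N ⋆ (½ ⋆ (fact j ⋆ fact j) ⋆ r j)     ≡⟨ solve 4 (λ N h f r → N :* (h :* f :* r) := N :* f :* (h :* r)) refl (ℕ→ℚ N) ½ (fact j ⋆ fact j) (r j) ⟩
  ℕ→ℚ N ⋆ (fact j ⋆ fact j) ⋆ (½ ⋆ r j)     ≡⟨ cong (λ s → ℕ→ℚ N ⋆ s ⋆ (½ ⋆ r j)) (ℕ→ℚ-* (j !) (j !)) ⟨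
  ℕ→ℚ N ⋆ ℕ→ℚ (j ! * j !) ⋆ (½ ⋆ r j)       ≡⟨ cong (_⋆ (½ ⋆ r j)) (ℕ→ℚ-* N (j ! * j !)) ⟨
  ℕ→ℚ (N * (j ! * j !)) ⋆ (½ ⋆ r j)         ≡⟨ cong (λ s → ℕ→ℚ s ⋆ (½ ⋆ r j)) ([1+j]C j) ⟩
  ℕ→ℚ (2 * suc (j ℕ.+ j) !) ⋆ (½ ⋆ r j)     ≡⟨ cong₂ _⋆_ (ℕ→ℚ-* 2 (suc (j ℕ.+ j) !)) refl ⟩
  2ℚ ⋆ fact (suc (j ℕ.+ j)) ⋆ (½ ⋆ r j)     ≡⟨ solve 2 (λ f r → con 2ℚ :* f :* (con ½ :* r) := r :* f) refl (fact (suc (j ℕ.+ j))) (r j) ⟩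
  r j ⋆ fact (suc (j ℕ.+ j))                ≡⟨ recipℕ-inverse (suc (j ℕ.+ j) !) {{suc (j ℕ.+ j) !≢0}} ⟩
  1ℚ                                        ∎)) (ℚₚ.*-identityʳ (recipℕ N)))
  where
  N = suc j * ((2 * suc j) C suc j)
  N≢0 = ℕₚ.m*n≢0 (suc j) ((2 * suc j) C suc j) {{_}} {{C-nonZero (suc j)}}

recipℕ-+ : ∀ a b → .{{_ : ℕ.NonZero a}} → .{{_ : ℕ.NonZero b}} →
  recipℕ a + recipℕ b ≡ ℕ→ℚ (a ℕ.+ b) ⋆ (recipℕ a ⋆ recipℕ b)
recipℕ-+ a b = begin
  x + y                                         ≡⟨ solve 2 (λ x y → x :+ y := con 1ℚ :* x :+ con 1ℚ :* y) refl x y ⟩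
  1ℚ ⋆ x + 1ℚ ⋆ y                               ≡⟨ cong₂ (λ s t → s ⋆ x + t ⋆ y) (recipℕ-inverse b) (recipℕ-inverse a) ⟨
  (y ⋆ ℕ→ℚ b) ⋆ x + (x ⋆ ℕ→ℚ a) ⋆ y             ≡⟨ solve 4 (λ x y a b → (y :* b) :* x :+ (x :* a) :* y := (a :+ b) :* (x :* y)) refl x y (ℕ→ℚ a) (ℕ→ℚ b) ⟩
  (ℕ→ℚ a + ℕ→ℚ b) ⋆ (x ⋆ y)                     ≡⟨ cong (_⋆ (x ⋆ y)) (ℕ→ℚ-+ a b) ⟨
  ℕ→ℚ (a ℕ.+ b) ⋆ (x ⋆ y)                       ∎
  where
  x = recipℕ a
  y = recipℕ b

-- Congruences modulo powers of p

halve : ∀ {n} → Prime n → 3 < n → ∃ λ h → n ≡ suc (h ℕ.+ h)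
halve {n} isPrime 3<n = [ (λ (h , e) → contradiction (2∣n h e) 2∤n) , id ]′ (parity n)
  where
  parity : ∀ n → (∃ λ h → n ≡ h ℕ.+ h) ⊎ (∃ λ h → n ≡ suc (h ℕ.+ h))
  parity zero    = inj₁ (0 , refl)
  parity (suc n) = [ (λ (h , e) → inj₂ (h , cong suc e)) , (λ (h , e) → inj₁ (suc h , trans (cong suc e) (cong suc (sym (ℕₚ.+-suc h h))))) ]′ (parity n)
  2∣n : ∀ h → n ≡ h ℕ.+ h → 2 ∣ n
  2∣n h e = divides h (trans e (trans (cong (h ℕ.+_) (sym (ℕₚ.+-identityʳ h))) (ℕₚ.*-comm 2 h)))
  2∤n : ¬ (2 ∣ n)
  2∤n 2∣n = [ (λ ()) , (λ { refl → ℕₚ.<⇒≱ 3<n (s≤s (s≤s z≤n)) }) ]′ (prime⇒irreducible isPrime 2∣n)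

-- With p written as `suc n`, the common upper limit p - 1 of the sums is the variable `n`.
module Congruences (n : ℕ) (isPrime : Prime (suc n)) (3<p : 3 < suc n) where

  open Localisation (suc n) isPrime

  π≡ : π ≡ 1ℚ + ι n
  π≡ = sym (ι≡ℕ→ℚ (suc n))

  π^2≡ : ℕ→ℚ (suc n ^ 2) ≡ π ⋆ π
  π^2≡ = trans (cong (λ m → ℕ→ℚ (suc n * m)) (ℕₚ.*-identityʳ (suc n))) (ℕ→ℚ-* (suc n) (suc n))

  Integral-ι : ∀ m → Integral (ι m)
  Integral-ι m = subst Integral (sym (ι≡ℕ→ℚ m)) (Integral-ℕ m)

  Integral-½ : Integral ½
  Integral-½ = Integral-recip< (ℕₚ.<-trans (s≤s (s≤s (s≤s z≤n))) 3<p)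

  Integral-squares : ∀ j {y} → Integral y → Integral (squares j y)
  Integral-squares zero    i = Integral-ℕ 1
  Integral-squares (suc j) i = Integral-⋆ (Integral-- (Integral-⋆ (Integral-ι (suc j)) (Integral-ι (suc j))) i) (Integral-squares j i)

  Integral-fact² : ∀ j → Integral (fact j ⋆ fact j)
  Integral-fact² j = Integral-⋆ (Integral-ℕ (j !)) (Integral-ℕ (j !))

  Integral-recip≤ : ∀ {i} → i < n → Integral (recipℕ (suc i))
  Integral-recip≤ i<n = Integral-recip< (s≤s i<n)

  Integral-H : ∀ j → j ≤ n → Integral (H j 2)
  Integral-H j j≤n = Integral-∑ j λ i i<j → subst Integral (sym (recipℕ-^2 (suc i)))
    (let x = Integral-recip≤ (ℕₚ.<-≤-trans i<j j≤n) in Integral-⋆ x x)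

  Div-2-ππ⋆ : ∀ {x} → Integral x → Div 2 (π ⋆ (π ⋆ x))
  Div-2-ππ⋆ i = Div-π⋆ (Div-π⋆ (Integral⇒Div-0 i))

  -- Up to sign, j!² H_j(2) is the linear coefficient of ∏_{i≤j} (i² - y). The inductions in
  -- `squares-p²` and `S-mod-p²` both run on this one recurrence.
  fact²H-suc : ∀ j → fact (suc j) ⋆ fact (suc j) ⋆ H (suc j) 2
    ≡ (1ℚ + ι j) ⋆ (1ℚ + ι j) ⋆ (fact j ⋆ fact j ⋆ H j 2) + fact j ⋆ fact j
  fact²H-suc j = begin
    fact (suc j) ⋆ fact (suc j) ⋆ (h + recipℕ (suc j ^ 2))  ≡⟨ cong₂ (λ s t → s ⋆ s ⋆ (h + t)) (fact-suc j) (recipℕ-^2 (suc j)) ⟩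
    (k ⋆ f) ⋆ (k ⋆ f) ⋆ (h + ρ ⋆ ρ)                        ≡⟨ solve 4 (λ k f h ρ → (k :* f) :* (k :* f) :* (h :+ ρ :* ρ) := k :* k :* (f :* f :* h) :+ f :* f :* ((ρ :* k) :* (ρ :* k))) refl k f h ρ ⟩
    k ⋆ k ⋆ (f ⋆ f ⋆ h) + f ⋆ f ⋆ ((ρ ⋆ k) ⋆ (ρ ⋆ k))       ≡⟨ cong (λ s → k ⋆ k ⋆ (f ⋆ f ⋆ h) + f ⋆ f ⋆ (s ⋆ s)) (recipℕ⋆ι j) ⟩
    k ⋆ k ⋆ (f ⋆ f ⋆ h) + f ⋆ f ⋆ (1ℚ ⋆ 1ℚ)                ≡⟨ cong (k ⋆ k ⋆ (f ⋆ f ⋆ h) +_) (ℚₚ.*-identityʳ (f ⋆ f)) ⟩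
    k ⋆ k ⋆ (f ⋆ f ⋆ h) + f ⋆ f                            ∎
    where
    k = 1ℚ + ι j
    f = fact j
    h = H j 2
    ρ = recipℕ (suc j)

  squares-p² : ∀ j → j ≤ n → Div 4 (squares j (π ⋆ π) - (fact j ⋆ fact j - π ⋆ π ⋆ (fact j ⋆ fact j ⋆ H j 2)))
  squares-p² zero    _   = subst (Div 4)
    (solve 1 (λ π → con 0ℚ := con 1ℚ :- (con 1ℚ :* con 1ℚ :- π :* π :* (con 1ℚ :* con 1ℚ :* con 0ℚ))) refl π) (Div-0 4)
  squares-p² (suc j) j<n = subst (Div 4) eq
    -- Multiplying the approximation for j by (j+1)² - p² gives the one for j + 1 and the excess p⁴
    -- j!² H_j(2). The second summand compensates for that excess.
    (Div-+ (Div-scale (Integral-- (Integral-⋆ (Integral-ι (suc j)) (Integral-ι (suc j))) (Integral-⋆ (Integral-ℕ (suc n)) (Integral-ℕ (suc n)))) (squares-p² j j≤n))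
           (Div-π⋆ (Div-π⋆ (Div-2-ππ⋆ (Integral-⋆ (Integral-fact² j) (Integral-H j j≤n))))))
    where
    j≤n = ℕₚ.<⇒≤ j<n
    k = 1ℚ + ι j
    f² = fact j ⋆ fact j
    h = H j 2
    q = squares j (π ⋆ π)
    eq : (k ⋆ k - π ⋆ π) ⋆ (q - (f² - π ⋆ π ⋆ (f² ⋆ h))) + π ⋆ (π ⋆ (π ⋆ (π ⋆ (f² ⋆ h))))
      ≡ squares (suc j) (π ⋆ π) - (fact (suc j) ⋆ fact (suc j) - π ⋆ π ⋆ (fact (suc j) ⋆ fact (suc j) ⋆ H (suc j) 2))
    eq = trans
      (solve 5 (λ k π q f h → (k :* k :- π :* π) :* (q :- (f :* f :- π :* π :* (f :* f :* h))) :+ π :* (π :* (π :* (π :* (f :* f :* h))))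
        := (k :* k :- π :* π) :* q :- ((k :* f) :* (k :* f) :- π :* π :* (k :* k :* (f :* f :* h) :+ f :* f))) refl k π q (fact j) h)
      (cong₂ (λ s t → squares (suc j) (π ⋆ π) - (s ⋆ s - π ⋆ π ⋆ t)) (sym (fact-suc j)) (sym (fact²H-suc j)))

  squares-p²-mod-p² : ∀ j → j ≤ n → Div 2 (squares j (π ⋆ π) - fact j ⋆ fact j)
  squares-p²-mod-p² j j≤n = subst (Div 2)
    (solve 4 (λ q f π h → (q :- (f :- π :* π :* (f :* h))) :- π :* (π :* (f :* h)) := q :- f) refl (squares j (π ⋆ π)) (fact j ⋆ fact j) π (H j 2))
    (Div-- (Div-weaken (Div-weaken (squares-p² j j≤n))) (Div-2-ππ⋆ (Integral-⋆ (Integral-fact² j) (Integral-H j j≤n))))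

  -- By `∑-central` and `central-shift` the sum is (p - 1 - j) C_j(p) / (2j + 2). Since C_j(p) is p
  -- times something congruent to j!² modulo p², the factor p - 1 - j acts as -(j + 1) modulo p² and
  -- cancels, leaving -1/2. The bound on j makes j + 1 invertible.
  ∑-central-mod-p² : ∀ j → j < n → Div 2 (∑ n (λ m → central j (ι m)) + ½ ⋆ (π ⋆ (fact j ⋆ fact j)))
  ∑-central-mod-p² j j<n = subst (Div 2) eq
    (Div-scale (Integral-⋆ Integral-½ (Integral-recip≤ j<n))
      (Div-- (Div-2-ππ⋆ (Integral-squares j (Integral-⋆ (Integral-ℕ (suc n)) (Integral-ℕ (suc n)))))
             (Div-scale (Integral-⋆ (Integral-ℕ (suc n)) (Integral-ι (suc j))) (squares-p²-mod-p² j (ℕₚ.<⇒≤ j<n)))))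
    where
    R = ∑ n (λ m → central j (ι m))
    J = ι j
    q = squares j (π ⋆ π)
    f² = fact j ⋆ fact j
    ρ = recipℕ (suc j)
    closed : (2ℚ ⋆ J + 2ℚ) ⋆ R ≡ (π - 1ℚ - J) ⋆ (π ⋆ q)
    closed = begin
      (2ℚ ⋆ J + 2ℚ) ⋆ R                             ≡⟨ ∑-central j n ⟩
      (1ℚ + ι n + J) ⋆ central j (ι n)              ≡⟨ central-shift j (ι n) ⟩
      (ι n - J) ⋆ central j (1ℚ + ι n)              ≡⟨ cong (λ s → (s - J) ⋆ central j (1ℚ + ι n)) (solve 1 (λ x → x := con 1ℚ :+ x :- con 1ℚ) refl (ι n)) ⟩
      (1ℚ + ι n - 1ℚ - J) ⋆ central j (1ℚ + ι n)    ≡⟨ cong (λ s → (s - 1ℚ - J) ⋆ central j s) π≡ ⟨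
      (π - 1ℚ - J) ⋆ (π ⋆ q)                        ∎
    eq : ½ ⋆ ρ ⋆ (π ⋆ (π ⋆ q) - π ⋆ (1ℚ + J) ⋆ (q - f²)) ≡ R + ½ ⋆ (π ⋆ f²)
    eq = begin
      ½ ⋆ ρ ⋆ (π ⋆ (π ⋆ q) - π ⋆ (1ℚ + J) ⋆ (q - f²))
        ≡⟨ solve 5 (λ ρ π q J f → con ½ :* ρ :* (π :* (π :* q) :- π :* (con 1ℚ :+ J) :* (q :- f))
             := con ½ :* ρ :* ((π :- con 1ℚ :- J) :* (π :* q)) :+ ρ :* (con 1ℚ :+ J) :* (con ½ :* (π :* f))) refl ρ π q J f² ⟩
      ½ ⋆ ρ ⋆ ((π - 1ℚ - J) ⋆ (π ⋆ q)) + ρ ⋆ (1ℚ + J) ⋆ (½ ⋆ (π ⋆ f²))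
        ≡⟨ cong (λ s → ½ ⋆ ρ ⋆ s + ρ ⋆ (1ℚ + J) ⋆ (½ ⋆ (π ⋆ f²))) closed ⟨
      ½ ⋆ ρ ⋆ ((2ℚ ⋆ J + 2ℚ) ⋆ R) + ρ ⋆ (1ℚ + J) ⋆ (½ ⋆ (π ⋆ f²))
        ≡⟨ solve 4 (λ ρ J R x → con ½ :* ρ :* ((con 2ℚ :* J :+ con 2ℚ) :* R) :+ ρ :* (con 1ℚ :+ J) :* x := ρ :* (con 1ℚ :+ J) :* (R :+ x)) refl ρ J R (½ ⋆ (π ⋆ f²)) ⟩
      ρ ⋆ (1ℚ + J) ⋆ (R + ½ ⋆ (π ⋆ f²))
        ≡⟨ cong (_⋆ (R + ½ ⋆ (π ⋆ f²))) (recipℕ⋆ι j) ⟩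
      1ℚ ⋆ (R + ½ ⋆ (π ⋆ f²))
        ≡⟨ ℚₚ.*-identityˡ (R + ½ ⋆ (π ⋆ f²)) ⟩
      R + ½ ⋆ (π ⋆ f²)
        ∎

  -- Power sums of reciprocals and Wolstenholme's congruence

  Integral-recip-reflect : ∀ i → i < n → Integral (recipℕ (n ∸ i))
  Integral-recip-reflect i i<n = Integral-recip (p∤small (s≤s (ℕₚ.m∸n≤m n i)) {{ℕ.>-nonZero (ℕₚ.m<n⇒0<n∸m i<n)}})

  recip-reflect≡ : ∀ i → i < n → recipℕ (suc i) + recipℕ (n ∸ i) ≡ π ⋆ (recipℕ (suc i) ⋆ recipℕ (n ∸ i))
  recip-reflect≡ i i<n = trans (recipℕ-+ (suc i) (n ∸ i) {{_}} {{ℕ.>-nonZero (ℕₚ.m<n⇒0<n∸m i<n)}})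
    (cong (λ s → ℕ→ℚ (suc s) ⋆ (recipℕ (suc i) ⋆ recipℕ (n ∸ i))) (ℕₚ.m+[n∸m]≡n (ℕₚ.<⇒≤ i<n)))

  recip-reflect : ∀ i → i < n → Div 1 (recipℕ (suc i) + recipℕ (n ∸ i))
  recip-reflect i i<n = subst (Div 1) (sym (recip-reflect≡ i i<n))
    (Div-π⋆ (Integral⇒Div-0 (Integral-⋆ (Integral-recip≤ i<n) (Integral-recip-reflect i i<n))))

  sq : ℕ → ℚ
  sq m = recipℕ m ⋆ recipℕ m

  sq-reflect : ∀ i → i < n → Div 1 (sq (n ∸ i) - sq (suc i))
  sq-reflect i i<n = subst (Div 1)
    (solve 2 (λ x y → (y :- x) :* (x :+ y) := y :* y :- x :* x) refl (recipℕ (suc i)) (recipℕ (n ∸ i)))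
    (Div-scale (Integral-- (Integral-recip-reflect i i<n) (Integral-recip≤ i<n)) (recip-reflect i i<n))

  -- Splitting the residues into halves, resp. into even and odd ones, and reflecting
  -- gives two relations whose difference is 3/2 times the sum over 1 ≤ m ≤ (p-1)/2.
  ∑-sq : Div 1 (∑ n sq)
  ∑-sq with halve isPrime 3<p
  ... | h , refl = subst (Div 1)
      (solve 2 (λ n a → (n :- con 2ℚ :* a) :+ con 2ℚ :* a := n) refl (∑ n sq) A)
      (Div-+ halves (Div-scale (Integral-ℕ 2) half))
    where
    A = ∑ h sq
    h≤n : h ≤ n
    h≤n = ℕₚ.m≤m+n h h
    upper : ∑ h (λ i → sq (h ℕ.+ i)) ≡ ∑ h (λ i → sq (suc n ∸ i))
    upper = trans (∑-reverse h (λ i → sq (h ℕ.+ i)))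
      (∑-cong h λ i i<h → cong sq (sym (ℕₚ.+-∸-assoc h (ℕₚ.<⇒≤ i<h))))
    halves : Div 1 (∑ n sq - 2ℚ ⋆ A)
    halves = subst (Div 1) eq (Div-∑ h λ i i<h → sq-reflect i (ℕₚ.<-≤-trans i<h h≤n))
      where
      eq : ∑ h (λ i → sq (suc n ∸ i) - sq i) ≡ ∑ n sq - 2ℚ ⋆ A
      eq = begin
        ∑ h (λ i → sq (suc n ∸ i) - sq i)        ≡⟨ ∑-- h (λ i → sq (suc n ∸ i)) sq ⟩
        ∑ h (λ i → sq (suc n ∸ i)) - A           ≡⟨ cong (_- A) upper ⟨
        ∑ h (λ i → sq (h ℕ.+ i)) - A             ≡⟨ solve 2 (λ a b → b :- a := (a :+ b) :- con 2ℚ :* a) refl A (∑ h (λ i → sq (h ℕ.+ i))) ⟩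
        A + ∑ h (λ i → sq (h ℕ.+ i)) - 2ℚ ⋆ A    ≡⟨ cong (_- 2ℚ ⋆ A) (∑-split h h sq) ⟨
        ∑ n sq - 2ℚ ⋆ A                          ∎
    sq-double : ∀ i → sq (i ℕ.+ i) ≡ ½ ⋆ ½ ⋆ sq i
    sq-double i = trans (cong (λ s → s ⋆ s) (trans (cong recipℕ (cong (i ℕ.+_) (sym (ℕₚ.+-identityʳ i)))) (recipℕ-* 2 i)))
      (solve 1 (λ x → (con ½ :* x) :* (con ½ :* x) := con ½ :* con ½ :* (x :* x)) refl (recipℕ i))
    evens : ∑ h (λ i → sq (i ℕ.+ i)) ≡ ½ ⋆ ½ ⋆ A
    evens = trans (∑-cong h λ i _ → sq-double (suc i)) (∑-⋆ h (½ ⋆ ½) sq)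
    -- The odd numbers below p = 2h + 1 are the p - 2i with 1 ≤ i ≤ h, so each is the reflection of
    -- an even one.
    odds : ∑ h (λ i → sq (ℕ.pred (i ℕ.+ i))) ≡ ∑ h (λ i → sq (suc n ∸ (i ℕ.+ i)))
    odds = trans (∑-reverse h (λ i → sq (ℕ.pred (i ℕ.+ i)))) (∑-cong h λ i i<h → cong sq (odd i i<h))
      where
      odd : ∀ i → i < h → ℕ.pred ((h ∸ i) ℕ.+ (h ∸ i)) ≡ suc (h ℕ.+ h) ∸ (suc i ℕ.+ suc i)
      odd i i<h = begin
        ℕ.pred ((h ∸ i) ℕ.+ (h ∸ i))         ≡⟨ cong (λ k → ℕ.pred ((k ∸ i) ℕ.+ (k ∸ i))) (ℕₚ.m+[n∸m]≡n (ℕₚ.<⇒≤ i<h)) ⟨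
        ℕ.pred ((i ℕ.+ d ∸ i) ℕ.+ (i ℕ.+ d ∸ i)) ≡⟨ cong (λ k → ℕ.pred (k ℕ.+ k)) (ℕₚ.m+n∸m≡n i d) ⟩
        ℕ.pred (d ℕ.+ d)                     ≡⟨ cong ℕ.pred (ℕₚ.m+n∸m≡n (i ℕ.+ i) (d ℕ.+ d)) ⟨
        ℕ.pred (i ℕ.+ i ℕ.+ (d ℕ.+ d) ∸ (i ℕ.+ i)) ≡⟨ cong (λ k → ℕ.pred (k ∸ (i ℕ.+ i))) (ℕ-solve 2 (λ i d → i ⊞ i ⊞ (d ⊞ d) ⊜ i ⊞ d ⊞ (i ⊞ d)) refl i d) ⟩
        ℕ.pred (i ℕ.+ d ℕ.+ (i ℕ.+ d) ∸ (i ℕ.+ i)) ≡⟨ cong (λ k → ℕ.pred (k ℕ.+ k ∸ (i ℕ.+ i))) (ℕₚ.m+[n∸m]≡n (ℕₚ.<⇒≤ i<h)) ⟩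
        ℕ.pred (h ℕ.+ h ∸ (i ℕ.+ i))         ≡⟨ ℕₚ.pred[m∸n]≡m∸[1+n] (h ℕ.+ h) (i ℕ.+ i) ⟩
        h ℕ.+ h ∸ suc (i ℕ.+ i)              ≡⟨ cong (h ℕ.+ h ∸_) (ℕₚ.+-suc i i) ⟨
        h ℕ.+ h ∸ (i ℕ.+ suc i)              ∎
        where d = h ∸ i
    parities : Div 1 (∑ n sq - ½ ⋆ A)
    parities = subst (Div 1) eq (Div-∑ h λ i i<h →
        sq-reflect (i ℕ.+ suc i) (ℕₚ.+-mono-≤ i<h i<h))
      where
      eq : ∑ h (λ i → sq (suc n ∸ (i ℕ.+ i)) - sq (i ℕ.+ i)) ≡ ∑ n sq - ½ ⋆ A
      eq = begin
        ∑ h (λ i → sq (suc n ∸ (i ℕ.+ i)) - sq (i ℕ.+ i))        ≡⟨ ∑-- h (λ i → sq (suc n ∸ (i ℕ.+ i))) (λ i → sq (i ℕ.+ i)) ⟩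
        ∑ h (λ i → sq (suc n ∸ (i ℕ.+ i))) - ∑ h (λ i → sq (i ℕ.+ i)) ≡⟨ cong₂ _-_ odds (sym evens) ⟨
        O - ½ ⋆ ½ ⋆ A                                            ≡⟨ solve 2 (λ o a → o :- con ½ :* con ½ :* a := (con ½ :* con ½ :* a :+ o) :- con ½ :* a) refl O A ⟩
        ½ ⋆ ½ ⋆ A + O - ½ ⋆ A                                    ≡⟨ cong (λ s → s + O - ½ ⋆ A) evens ⟨
        ∑ h (λ i → sq (i ℕ.+ i)) + O - ½ ⋆ A                     ≡⟨ cong (_- ½ ⋆ A) (∑-evenOdd h sq) ⟨
        ∑ n sq - ½ ⋆ A                                           ∎
        where O = ∑ h (λ i → sq (ℕ.pred (i ℕ.+ i)))
    half : Div 1 A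
    half = subst (Div 1)
      (solve 2 (λ n a → con (2ℚ ⋆ recipℕ 3) :* ((n :- con ½ :* a) :- (n :- con 2ℚ :* a)) := a) refl (∑ n sq) A)
      -- The constant 2/3 undoes the factor 3/2; it is p-integral because p > 3.
      (Div-scale (Integral-⋆ (Integral-ℕ 2) (Integral-recip< 3<p)) (Div-- parities halves))

  ∑-reflect : ∀ f → 2ℚ ⋆ ∑ n f ≡ ∑ n (λ i → f i + f (suc n ∸ i))
  ∑-reflect f = begin
    2ℚ ⋆ ∑ n f                           ≡⟨ solve 1 (λ x → con 2ℚ :* x := x :+ x) refl (∑ n f) ⟩
    ∑ n f + ∑ n f                        ≡⟨ cong (∑ n f +_) (∑-reverse n f) ⟩
    ∑ n f + ∑ n (λ i → f (suc n ∸ i))    ≡⟨ ∑-+ n f (λ i → f (suc n ∸ i)) ⟨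
    ∑ n (λ i → f i + f (suc n ∸ i))      ∎

  Div-halve : ∀ {m x} → Div m (2ℚ ⋆ x) → Div m x
  Div-halve {m} {x} d = subst (Div m) (solve 1 (λ x → con ½ :* (con 2ℚ :* x) := x) refl x) (Div-scale Integral-½ d)

  -- Pairing m with p - m gives 2 ∑ 1/m = p ∑ 1/(m (p-m)). One factor p is thus explicit; the other
  -- comes from 1/(m (p-m)) ≡ -1/m² (mod p) and `∑-sq`.
  ∑-recip : Div 2 (∑ n recipℕ)
  ∑-recip = Div-halve (subst (Div 2) (sym eq) (Div-π⋆ products))
    where
    product : ℕ → ℚ
    product i = recipℕ i ⋆ recipℕ (suc n ∸ i)
    eq : 2ℚ ⋆ ∑ n recipℕ ≡ π ⋆ ∑ n product
    eq = trans (∑-reflect recipℕ) (trans (∑-cong n recip-reflect≡) (∑-⋆ n π product))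
    products : Div 1 (∑ n product)
    products = subst (Div 1)
      (trans (cong (_- ∑ n sq) (∑-+ n product sq)) (solve 2 (λ a b → a :+ b :- b := a) refl (∑ n product) (∑ n sq)))
      (Div-- (Div-∑ n λ i i<n → subst (Div 1)
          (solve 2 (λ x y → x :* (x :+ y) := x :* y :+ x :* x) refl (recipℕ (suc i)) (recipℕ (n ∸ i)))
          (Div-scale (Integral-recip≤ i<n) (recip-reflect i i<n)))
        ∑-sq)

  -- Under m ↦ p - m the cubes pair up, and x³ + y³ is a multiple of x + y. It serves the constant
  -- coefficients of the second and fourth congruences, because every v_k(2 - t) has constant term
  -- 2.
  ∑-recip³ : Div 1 (∑ n (λ m → recipℕ (m ^ 3)))
  ∑-recip³ = Div-halve (subst (Div 1) (sym (∑-reflect (λ m → recipℕ (m ^ 3)))) (Div-∑ n λ i i<n →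
    let x = recipℕ (suc i); y = recipℕ (n ∸ i); Ix = Integral-recip≤ i<n; Iy = Integral-recip-reflect i i<n in
    subst (Div 1)
      (trans (solve 2 (λ x y → (x :* x :- x :* y :+ y :* y) :* (x :+ y) := x :* (x :* x) :+ y :* (y :* y)) refl x y)
        (sym (cong₂ _+_ (recipℕ-^3 (suc i)) (recipℕ-^3 (n ∸ i)))))
      (Div-scale (Integral-+ (Integral-- (Integral-⋆ Ix Ix) (Integral-⋆ Ix Iy)) (Integral-⋆ Iy Iy)) (recip-reflect i i<n))))

  -- The sums S_j modulo p²

  S : ℕ → ℚ
  S j = ∑ n (λ m → recipℕ m ⋆ squares j (ι m ⋆ ι m))

  S-suc : ∀ j → S (suc j) ≡ (1ℚ + ι j) ⋆ (1ℚ + ι j) ⋆ S j - ∑ n (λ m → central j (ι m))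
  S-suc j = begin
    S (suc j)
      ≡⟨ ∑-cong n (λ i _ → term i) ⟩
    ∑ n (λ m → k ⋆ k ⋆ (recipℕ m ⋆ squares j (ι m ⋆ ι m)) - central j (ι m))
      ≡⟨ ∑-- n (λ m → k ⋆ k ⋆ (recipℕ m ⋆ squares j (ι m ⋆ ι m))) (λ m → central j (ι m)) ⟩
    ∑ n (λ m → k ⋆ k ⋆ (recipℕ m ⋆ squares j (ι m ⋆ ι m))) - ∑ n (λ m → central j (ι m))
      ≡⟨ cong (_- ∑ n (λ m → central j (ι m))) (∑-⋆ n (k ⋆ k) (λ m → recipℕ m ⋆ squares j (ι m ⋆ ι m))) ⟩
    k ⋆ k ⋆ S j - ∑ n (λ m → central j (ι m))
      ∎
    where
    k = 1ℚ + ι j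
    term : ∀ i → recipℕ (suc i) ⋆ squares (suc j) (ι (suc i) ⋆ ι (suc i))
      ≡ k ⋆ k ⋆ (recipℕ (suc i) ⋆ squares j (ι (suc i) ⋆ ι (suc i))) - central j (ι (suc i))
    term i = begin
      x ⋆ ((k ⋆ k - m ⋆ m) ⋆ q)               ≡⟨ solve 4 (λ x k m q → x :* ((k :* k :- m :* m) :* q) := k :* k :* (x :* q) :- (x :* m) :* (m :* q)) refl x k m q ⟩
      k ⋆ k ⋆ (x ⋆ q) - (x ⋆ m) ⋆ (m ⋆ q)     ≡⟨ cong (λ s → k ⋆ k ⋆ (x ⋆ q) - s ⋆ (m ⋆ q)) (recipℕ⋆ι i) ⟩
      k ⋆ k ⋆ (x ⋆ q) - 1ℚ ⋆ (m ⋆ q)          ≡⟨ cong (λ s → k ⋆ k ⋆ (x ⋆ q) - s) (ℚₚ.*-identityˡ (m ⋆ q)) ⟩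
      k ⋆ k ⋆ (x ⋆ q) - m ⋆ q                 ∎
      where
      x = recipℕ (suc i)
      m = ι (suc i)
      q = squares j (m ⋆ m)

  S-mod-p² : ∀ j → j ≤ n → Div 2 (S j - ½ ⋆ (π ⋆ (fact j ⋆ fact j ⋆ H j 2)))
  S-mod-p² zero _ = subst (Div 2)
    (trans (∑-cong n λ i _ → sym (ℚₚ.*-identityʳ (recipℕ (suc i))))
      (solve 2 (λ s π → s := s :- con ½ :* (π :* (con 1ℚ :* con 1ℚ :* con 0ℚ))) refl (S 0) π)) ∑-recip
  S-mod-p² (suc j) j<n = subst (Div 2) eq
    (Div-- (Div-scale (Integral-⋆ (Integral-ι (suc j)) (Integral-ι (suc j))) (S-mod-p² j (ℕₚ.<⇒≤ j<n))) (∑-central-mod-p² j j<n))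
    where
    k = 1ℚ + ι j
    f² = fact j ⋆ fact j
    R = ∑ n (λ m → central j (ι m))
    eq : k ⋆ k ⋆ (S j - ½ ⋆ (π ⋆ (f² ⋆ H j 2))) - (R + ½ ⋆ (π ⋆ f²))
      ≡ S (suc j) - ½ ⋆ (π ⋆ (fact (suc j) ⋆ fact (suc j) ⋆ H (suc j) 2))
    eq = trans
      (solve 6 (λ k s π f h R → k :* k :* (s :- con ½ :* (π :* (f :* h))) :- (R :+ con ½ :* (π :* f))
        := (k :* k :* s :- R) :- con ½ :* (π :* (k :* k :* (f :* h) :+ f))) refl k (S j) π f² (H j 2) R)
      (cong₂ (λ s t → s - ½ ⋆ (π ⋆ t)) (sym (S-suc j)) (sym (fact²H-suc j)))

  -- Comparison of coefficients

  c c² : ℕ → ℚ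
  c  k = recipℕ (k * ((2 * k) C k))
  c² k = recipℕ (k ^ 2 * ((2 * k) C k))

  c²≡ : ∀ k → c² k ≡ recipℕ k ⋆ c k
  c²≡ k = begin
    c² k                          ≡⟨ recipℕ-* (k ^ 2) b ⟩
    recipℕ (k ^ 2) ⋆ recipℕ b     ≡⟨ cong (_⋆ recipℕ b) (recipℕ-^2 k) ⟩
    recipℕ k ⋆ recipℕ k ⋆ recipℕ b   ≡⟨ ℚₚ.*-assoc (recipℕ k) (recipℕ k) (recipℕ b) ⟩
    recipℕ k ⋆ (recipℕ k ⋆ recipℕ b) ≡⟨ cong (recipℕ k ⋆_) (recipℕ-* k b) ⟨
    recipℕ k ⋆ c k                ∎
    where b = (2 * k) C k

  -- Only k = i contributes, so a factor 1/k under the sum may be exchanged for the constant 1/i and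
  -- pulled out.
  recip-T^ : ∀ k i → recipℕ k ⋆ coeff (T^ k) i ≡ recipℕ i ⋆ coeff (T^ k) i
  recip-T^ k i with k ℕ.≟ i
  ... | yes refl = refl
  ... | no  k≢i  rewrite coeff-T^-≢ k i k≢i = trans (ℚₚ.*-zeroʳ (recipℕ k)) (sym (ℚₚ.*-zeroʳ (recipℕ i)))

  series : (ℕ → ℚ) → ℕ → ℚ
  series a i = ∑ n (λ k → a k ⋆ coeff (T^ k) i)

  series-recip : ∀ {a b : ℕ → ℚ} → (∀ k → b k ≡ recipℕ k ⋆ a k) → ∀ i → series b i ≡ recipℕ i ⋆ series a i
  series-recip {a} {b} b≡ i = trans (∑-cong n λ k _ → term (suc k)) (∑-⋆ n (recipℕ i) (λ k → a k ⋆ coeff (T^ k) i))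
    where
    term : ∀ k → b k ⋆ coeff (T^ k) i ≡ recipℕ i ⋆ (a k ⋆ coeff (T^ k) i)
    term k = begin
      b k ⋆ t                   ≡⟨ cong (_⋆ t) (b≡ k) ⟩
      recipℕ k ⋆ a k ⋆ t        ≡⟨ solve 3 (λ x a t → x :* a :* t := a :* (x :* t)) refl (recipℕ k) (a k) t ⟩
      a k ⋆ (recipℕ k ⋆ t)      ≡⟨ cong (a k ⋆_) (recip-T^ k i) ⟩
      a k ⋆ (recipℕ i ⋆ t)      ≡⟨ solve 3 (λ x a t → a :* (x :* t) := x :* (a :* t)) refl (recipℕ i) (a k) t ⟩
      recipℕ i ⋆ (a k ⋆ t)      ∎
      where t = coeff (T^ k) i

  series-zero : ∀ a → series a 0 ≡ 0ℚ
  series-zero a = ∑-T^-≢ n a 0 (λ _ _ ())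

  series-≥ : ∀ a j → n ≤ j → series a (suc j) ≡ 0ℚ
  series-≥ a j n≤j = ∑-T^-≢ n a (suc j) (λ k k<n e → ℕₚ.<⇒≢ (ℕₚ.<-≤-trans k<n n≤j) (ℕₚ.suc-injective e))

  W V : ℕ → ℚ
  W j = ∑ n (λ m → recipℕ (m ^ 2) ⋆ u m j)
  V i = ∑ n (λ m → recipℕ (m ^ 3) ⋆ v m i)

  W≡ : ∀ j → W j ≡ r j ⋆ S j
  W≡ j = trans (∑-cong n λ i _ → term i) (∑-⋆ n (r j) (λ m → recipℕ m ⋆ squares j (ι m ⋆ ι m)))
    where
    term : ∀ i → recipℕ (suc i ^ 2) ⋆ u (suc i) j ≡ r j ⋆ (recipℕ (suc i) ⋆ squares j (ι (suc i) ⋆ ι (suc i)))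
    term i = begin
      recipℕ (suc i ^ 2) ⋆ u (suc i) j      ≡⟨ cong₂ _⋆_ (recipℕ-^2 (suc i)) (u≡ (suc i) j) ⟩
      x ⋆ x ⋆ (r j ⋆ (m ⋆ q))               ≡⟨ solve 4 (λ x r m q → x :* x :* (r :* (m :* q)) := r :* ((x :* m) :* (x :* q))) refl x (r j) m q ⟩
      r j ⋆ ((x ⋆ m) ⋆ (x ⋆ q))             ≡⟨ cong (λ s → r j ⋆ (s ⋆ (x ⋆ q))) (recipℕ⋆ι i) ⟩
      r j ⋆ (1ℚ ⋆ (x ⋆ q))                  ≡⟨ cong (r j ⋆_) (ℚₚ.*-identityˡ (x ⋆ q)) ⟩
      r j ⋆ (x ⋆ q)                         ∎
      where
      x = recipℕ (suc i)
      m = ι (suc i)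
      q = squares j (m ⋆ m)

  W-≥ : ∀ j → n ≤ j → W j ≡ 0ℚ
  W-≥ j n≤j = trans (∑-cong n λ i i<n → trans (cong (recipℕ (suc i ^ 2) ⋆_) (u-vanish (suc i) j (ℕₚ.≤-trans i<n n≤j))) (ℚₚ.*-zeroʳ (recipℕ (suc i ^ 2)))) (∑-0 n)

  V-suc : ∀ j → V (suc j) ≡ (- recipℕ (suc j)) ⋆ W j
  V-suc j = trans (∑-cong n λ i _ → term i) (∑-⋆ n (- ρ) (λ m → recipℕ (m ^ 2) ⋆ u m j))
    where
    ρ = recipℕ (suc j)
    term : ∀ i → recipℕ (suc i ^ 3) ⋆ v (suc i) (suc j) ≡ (- ρ) ⋆ (recipℕ (suc i ^ 2) ⋆ u (suc i) j)
    term i = begin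
      recipℕ (suc i ^ 3) ⋆ v (suc i) (suc j)      ≡⟨ cong₂ _⋆_ (recipℕ-^3 (suc i)) (v≡ (suc i) j) ⟩
      x ⋆ (x ⋆ x) ⋆ (- (ρ ⋆ (m ⋆ w)))             ≡⟨ solve 4 (λ x ρ m w → x :* (x :* x) :* (:- (ρ :* (m :* w))) := (:- ρ) :* (x :* x :* ((x :* m) :* w))) refl x ρ m w ⟩
      (- ρ) ⋆ (x ⋆ x ⋆ ((x ⋆ m) ⋆ w))             ≡⟨ cong (λ s → (- ρ) ⋆ (x ⋆ x ⋆ (s ⋆ w))) (recipℕ⋆ι i) ⟩
      (- ρ) ⋆ (x ⋆ x ⋆ (1ℚ ⋆ w))                  ≡⟨ cong₂ (λ s t → (- ρ) ⋆ (s ⋆ t)) (sym (recipℕ-^2 (suc i))) (ℚₚ.*-identityˡ w) ⟩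
      (- ρ) ⋆ (recipℕ (suc i ^ 2) ⋆ w)            ∎
      where
      x = recipℕ (suc i)
      m = ι (suc i)
      w = u (suc i) j

  V-zero : Div 1 (V 0)
  V-zero = subst (Div 1)
    (sym (trans (∑-cong n λ i _ → trans (cong (recipℕ (suc i ^ 3) ⋆_) (v-zero (suc i))) (ℚₚ.*-comm (recipℕ (suc i ^ 3)) 2ℚ)) (∑-⋆ n 2ℚ (λ m → recipℕ (m ^ 3)))))
    (Div-scale (Integral-ℕ 2) ∑-recip³)

  p² : ℚ
  p² = ℕ→ℚ (suc n ^ 2)

  Div-p²⋆ : ∀ {x} → Div 1 x → Div 3 (p² ⋆ x)
  Div-p²⋆ {x} d = subst (Div 3) (trans (sym (ℚₚ.*-assoc π π x)) (cong (_⋆ x) (sym π^2≡))) (Div-π⋆ (Div-π⋆ d))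

  Hc : ℕ → ℚ
  Hc k = H (k ∸ 1) 2 ⋆ c k

  -- The coefficients of t^(j+1) in left side minus right side of the first and third congruences.
  error₁ error₃ : ℕ → ℚ
  error₁ j = π ⋆ series c (suc j) - (½ ⋆ (u (suc n) j - coeff (T^ (suc n)) (suc j)) + p² ⋆ W j)
  error₃ j = π ⋆ series Hc (suc j) - W j

  Integral-π⋆r : ∀ j → j < n → Integral (π ⋆ r j)
  Integral-π⋆r j j<n = Integral-π⋆recip-! (suc (j ℕ.+ j)) (s≤s (ℕₚ.≤-trans (ℕₚ.+-mono-< j<n j<n) (ℕₚ.+-monoʳ-≤ n (ℕₚ.n≤1+n n))))

  -- The error is the negative of S_j - (p/2) j!² H_j(2), divided by (2j+1)!. That division takes
  -- the congruence for S_j from modulo p² to modulo p.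
  error₃-< : ∀ j → j < n → Div 1 (error₃ j)
  error₃-< j j<n = subst (Div 1) eq (Div-unscale (Integral-π⋆r j j<n) (Div-neg (S-mod-p² j (ℕₚ.<⇒≤ j<n))))
    where
    f² = fact j ⋆ fact j
    h = H j 2
    eq : r j ⋆ (- (S j - ½ ⋆ (π ⋆ (f² ⋆ h)))) ≡ error₃ j
    eq = begin
      r j ⋆ (- (S j - ½ ⋆ (π ⋆ (f² ⋆ h))))       ≡⟨ solve 5 (λ r s π f h → r :* (:- (s :- con ½ :* (π :* (f :* h)))) := π :* (h :* (con ½ :* f :* r)) :- r :* s) refl (r j) (S j) π f² h ⟩
      π ⋆ (h ⋆ (½ ⋆ f² ⋆ r j)) - r j ⋆ S j       ≡⟨ cong₂ (λ s t → π ⋆ (h ⋆ s) - t) (recip-kC j) (W≡ j) ⟨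
      π ⋆ Hc (suc j) - W j                       ≡⟨ cong (λ s → π ⋆ s - W j) (∑-T^-≡ n Hc j j<n) ⟨
      error₃ j                                   ∎

  error₃-≥ : ∀ j → n ≤ j → error₃ j ≡ 0ℚ
  error₃-≥ j n≤j = trans (cong₂ (λ s t → π ⋆ s - t) (series-≥ Hc j n≤j) (W-≥ j n≤j)) (solve 1 (λ π → π :* con 0ℚ :- con 0ℚ := con 0ℚ) refl π)

  -- The p² H_j(2) term in the expansion of C_j(p) is, after scaling, p² times the left side of the
  -- third congruence. So `error₁ j` splits into p² `error₃ j` and a p-integral multiple of the
  -- remainder of that expansion.
  error₁-< : ∀ j → j < n → Div 3 (error₁ j)
  error₁-< j j<n = subst (Div 3) eq
    (Div-+ (Div-weaken (Div-scale (Integral-neg (Integral-⋆ Integral-½ (Integral-π⋆r j j<n))) (squares-p² j (ℕₚ.<⇒≤ j<n))))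
           (Div-p²⋆ (error₃-< j j<n)))
    where
    f² = fact j ⋆ fact j
    h = H j 2
    q = squares j (π ⋆ π)
    u-p : r j ⋆ (π ⋆ q) ≡ u (suc n) j
    u-p = trans (cong (λ s → r j ⋆ central j s) π≡) (sym (u≡ (suc n) j))
    eq : (- (½ ⋆ (π ⋆ r j))) ⋆ (q - (f² - π ⋆ π ⋆ (f² ⋆ h))) + p² ⋆ error₃ j ≡ error₁ j
    eq = begin
      (- (½ ⋆ (π ⋆ r j))) ⋆ (q - (f² - π ⋆ π ⋆ (f² ⋆ h))) + p² ⋆ error₃ j
        ≡⟨ cong₂ (λ s t → (- (½ ⋆ (π ⋆ r j))) ⋆ (q - (f² - s ⋆ (f² ⋆ h))) + p² ⋆ (π ⋆ t - W j)) (sym π^2≡) (trans (∑-T^-≡ n Hc j j<n) (cong (h ⋆_) (recip-kC j))) ⟩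
      (- (½ ⋆ (π ⋆ r j))) ⋆ (q - (f² - p² ⋆ (f² ⋆ h))) + p² ⋆ (π ⋆ (h ⋆ (½ ⋆ f² ⋆ r j)) - W j)
        ≡⟨ solve 7 (λ π r q f h p² w → (:- (con ½ :* (π :* r))) :* (q :- (f :- p² :* (f :* h))) :+ p² :* (π :* (h :* (con ½ :* f :* r)) :- w)
             := π :* (con ½ :* f :* r) :- (con ½ :* (r :* (π :* q) :- con 0ℚ) :+ p² :* w)) refl π (r j) q f² h p² (W j) ⟩
      π ⋆ (½ ⋆ f² ⋆ r j) - (½ ⋆ (r j ⋆ (π ⋆ q) - 0ℚ) + p² ⋆ W j)
        -- The `0ℚ` is the coefficient of tᵖ read at j + 1 < p.
        ≡⟨ cong₂ (λ s t → π ⋆ s - (½ ⋆ t + p² ⋆ W j)) (sym (trans (∑-T^-≡ n c j j<n) (recip-kC j)))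
             (cong₂ _-_ u-p (sym (coeff-T^-≢ (suc n) (suc j) (λ e → ℕₚ.<⇒≢ j<n (sym (ℕₚ.suc-injective e)))))) ⟩
      error₁ j
        ∎

  -- The polynomial u_p(2 - t) has degree p - 1 and leading coefficient (-1)^(p-1), which is 1 as p
  -- is odd. The term -tᵖ of the first congruence removes exactly this.
  u-p-≥ : ∀ j → n ≤ j → u (suc n) j ≡ coeff (T^ (suc n)) (suc j)
  u-p-≥ j n≤j with n ℕ.≟ j
  ... | yes refl = trans (u-top n) (trans n-even (sym (coeff-T^-≡ (suc n))))
    where
    n-even : -1^ n ≡ 1ℚ
    n-even with h , refl ← halve isPrime 3<p = -1^-even h
  ... | no  n≢j = trans (u-vanish (suc n) j (ℕₚ.≤∧≢⇒< n≤j n≢j)) (sym (coeff-T^-≢ (suc n) (suc j) (n≢j ∘ ℕₚ.suc-injective)))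

  error₁-≥ : ∀ j → n ≤ j → error₁ j ≡ 0ℚ
  error₁-≥ j n≤j = begin
    π ⋆ series c (suc j) - (½ ⋆ (u (suc n) j - t) + p² ⋆ W j)   ≡⟨ cong₂ (λ s w → π ⋆ s - (½ ⋆ (u (suc n) j - t) + p² ⋆ w)) (series-≥ c j n≤j) (W-≥ j n≤j) ⟩
    π ⋆ 0ℚ - (½ ⋆ (u (suc n) j - t) + p² ⋆ 0ℚ)                  ≡⟨ cong (λ s → π ⋆ 0ℚ - (½ ⋆ (s - t) + p² ⋆ 0ℚ)) (u-p-≥ j n≤j) ⟩
    π ⋆ 0ℚ - (½ ⋆ (t - t) + p² ⋆ 0ℚ)                            ≡⟨ solve 3 (λ π t p² → π :* con 0ℚ :- (con ½ :* (t :- t) :+ p² :* con 0ℚ) := con 0ℚ) refl π t p² ⟩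
    0ℚ                                                          ∎
    where t = coeff (T^ (suc n)) (suc j)

  -- For j < n the number j + 1 is prime to p. For larger j, among them j + 1 = p, the error is zero
  -- on the nose, so dividing it by j + 1 is harmless as well.
  Div-error : ∀ {m} (e : ℕ → ℚ) → (∀ j → j < n → Div m (e j)) → (∀ j → n ≤ j → e j ≡ 0ℚ) →
    ∀ j → Div m (e j) × Div m (recipℕ (suc j) ⋆ e j)
  Div-error {m} e small large j with j ℕ.<? n
  ... | yes j<n = small j j<n , Div-scale (Integral-recip≤ j<n) (small j j<n)
  ... | no  j≮n = subst (Div m) (sym ej≡0) (Div-0 m) , subst (Div m) (sym (trans (cong (recipℕ (suc j) ⋆_) ej≡0) (ℚₚ.*-zeroʳ (recipℕ (suc j))))) (Div-0 m)
    where ej≡0 = large j (ℕₚ.≮⇒≥ j≮n)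

  Div-error₁ : ∀ j → Div 3 (error₁ j) × Div 3 (recipℕ (suc j) ⋆ error₁ j)
  Div-error₁ = Div-error error₁ error₁-< error₁-≥

  Div-error₃ : ∀ j → Div 1 (error₃ j) × Div 1 (recipℕ (suc j) ⋆ error₃ j)
  Div-error₃ = Div-error error₃ error₃-< error₃-≥

  -- From coefficients to the polynomial congruences

  coeff-series : ∀ a i → coeff (π · sumP n (λ k → a k · T^ k)) i ≡ π ⋆ series a i
  coeff-series a i = trans (coeff-· π (sumP n (λ k → a k · T^ k)) i) (cong (π ⋆_)
    (trans (coeff-sumP n (λ k → a k · T^ k) i) (∑-cong n λ k _ → coeff-· (a (suc k)) (T^ (suc k)) i)))

  sumU sumV : Poly
  sumU = sumP n (λ k → recipℕ (k ^ 2) · (lucasU k ∘P twoMinusT))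
  sumV = sumP n (λ k → recipℕ (k ^ 3) · (lucasV k ∘P twoMinusT))

  coeff-sumU : ∀ i → coeff sumU i ≡ W i
  coeff-sumU i = trans (coeff-sumP n (λ k → recipℕ (k ^ 2) · (lucasU k ∘P twoMinusT)) i)
    (∑-cong n λ k _ → coeff-· (recipℕ (suc k ^ 2)) (lucasU (suc k) ∘P twoMinusT) i)

  coeff-sumV : ∀ i → coeff sumV i ≡ V i
  coeff-sumV i = trans (coeff-sumP n (λ k → recipℕ (k ^ 3) · (lucasV k ∘P twoMinusT)) i)
    (∑-cong n λ k _ → coeff-· (recipℕ (suc k ^ 3)) (lucasV (suc k) ∘P twoMinusT) i)

  rhs₁ rhs₂ : Poly
  rhs₁ = recipℕ 2 · ((T ⊗ (lucasU (suc n) ∘P twoMinusT)) ⊖ T^ (suc n)) ⊕ ℕ→ℚ (suc n ^ 2) · (T ⊗ sumU)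
  rhs₂ = (recipℕ (2 * suc n) · ((const (ℕ→ℚ 2) ⊖ (lucasV (suc n) ∘P twoMinusT)) ⊖ T^ (suc n))) ⊖ ℕ→ℚ (suc n ^ 2) · sumV

  coeff-rhs₁ : ∀ i → coeff rhs₁ i ≡
    ½ ⋆ (coeff (0ℚ ∷ (lucasU (suc n) ∘P twoMinusT)) i - coeff (T^ (suc n)) i) + p² ⋆ coeff (0ℚ ∷ sumU) i
  coeff-rhs₁ i = trans (coeff-⊕ (½ · (tu ⊖ T^ (suc n))) (p² · (T ⊗ sumU)) i) (cong₂ _+_
    (trans (coeff-· ½ (tu ⊖ T^ (suc n)) i) (cong (½ ⋆_) (trans (coeff-⊖ tu (T^ (suc n)) i)
      (cong (_- coeff (T^ (suc n)) i) (coeff-T⊗ (lucasU (suc n) ∘P twoMinusT) i)))))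
    (trans (coeff-· p² (T ⊗ sumU) i) (cong (p² ⋆_) (coeff-T⊗ sumU i))))
    where tu = T ⊗ (lucasU (suc n) ∘P twoMinusT)

  coeff-rhs₂ : ∀ i → coeff rhs₂ i ≡
    recipℕ (2 * suc n) ⋆ (coeff (const 2ℚ) i - v (suc n) i - coeff (T^ (suc n)) i) - p² ⋆ V i
  coeff-rhs₂ i = trans (coeff-⊖ (recipℕ (2 * suc n) · ((const 2ℚ ⊖ vp) ⊖ T^ (suc n))) (p² · sumV) i) (cong₂ _-_
    (trans (coeff-· (recipℕ (2 * suc n)) ((const 2ℚ ⊖ vp) ⊖ T^ (suc n)) i) (cong (recipℕ (2 * suc n) ⋆_)
      (trans (coeff-⊖ (const 2ℚ ⊖ vp) (T^ (suc n)) i) (cong (_- coeff (T^ (suc n)) i) (coeff-⊖ (const 2ℚ) vp i)))))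
    (trans (coeff-· p² sumV i) (cong (p² ⋆_) (coeff-sumV i))))
    where vp = lucasV (suc n) ∘P twoMinusT

  congruence₁ : CongP (suc n) 3 (π · sumP n (λ k → c k · T^ k)) rhs₁
  congruence₁ i = Div⇒InPowZp (subst (Div 3) (sym (trans (coeff-⊖ (π · sumP n (λ k → c k · T^ k)) rhs₁ i)
    (cong₂ _-_ (coeff-series c i) (coeff-rhs₁ i)))) (cases i))
    where
    cases : ∀ i → Div 3 (π ⋆ series c i - (½ ⋆ (coeff (0ℚ ∷ (lucasU (suc n) ∘P twoMinusT)) i - coeff (T^ (suc n)) i) + p² ⋆ coeff (0ℚ ∷ sumU) i))
    cases zero = subst (Div 3) (sym (trans
      (cong₂ (λ s t → π ⋆ s - (½ ⋆ (0ℚ - t) + p² ⋆ 0ℚ)) (series-zero c) (coeff-T^-≢ (suc n) 0 (λ ())))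
      (solve 2 (λ π p² → π :* con 0ℚ :- (con ½ :* (con 0ℚ :- con 0ℚ) :+ p² :* con 0ℚ) := con 0ℚ) refl π p²))) (Div-0 3)
    cases (suc j) = subst (λ w → Div 3 (π ⋆ series c (suc j) - (½ ⋆ (u (suc n) j - coeff (T^ (suc n)) (suc j)) + p² ⋆ w)))
      (sym (coeff-sumU j)) (proj₁ (Div-error₁ j))

  congruence₂ : CongP (suc n) 3 (π · sumP n (λ k → c² k · T^ k)) rhs₂
  congruence₂ i = Div⇒InPowZp (subst (Div 3) (sym (trans (coeff-⊖ (π · sumP n (λ k → c² k · T^ k)) rhs₂ i)
    (cong₂ _-_ (coeff-series c² i) (coeff-rhs₂ i)))) (cases i))
    where
    ρp = recipℕ (suc n)
    cases : ∀ i → Div 3 (π ⋆ series c² i - (recipℕ (2 * suc n) ⋆ (coeff (const 2ℚ) i - v (suc n) i - coeff (T^ (suc n)) i) - p² ⋆ V i))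
    -- At t⁰ the numerator over 2p is 2 - 2 - 0, so only p² times the constant term of the v-sum is
    -- left.
    cases zero = subst (Div 3) (sym eq) (Div-p²⋆ V-zero)
      where
      eq : π ⋆ series c² 0 - (recipℕ (2 * suc n) ⋆ (2ℚ - v (suc n) 0 - coeff (T^ (suc n)) 0) - p² ⋆ V 0) ≡ p² ⋆ V 0
      eq = trans
        (cong₂ (λ s t → π ⋆ s - (recipℕ (2 * suc n) ⋆ t - p² ⋆ V 0)) (series-zero c²)
          (cong₂ (λ s t → 2ℚ - s - t) (v-zero (suc n)) (coeff-T^-≢ (suc n) 0 (λ ()))))
        (solve 3 (λ π a b → π :* con 0ℚ :- (a :* con 0ℚ :- b) := b) refl π (recipℕ (2 * suc n)) (p² ⋆ V 0))
    cases (suc j) = subst (Div 3) (sym eq) (proj₂ (Div-error₁ j))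
      where
      ρ = recipℕ (suc j)
      t = coeff (T^ (suc n)) (suc j)
      w = u (suc n) j
      s = series c (suc j)
      eq : π ⋆ series c² (suc j) - (recipℕ (2 * suc n) ⋆ (0ℚ - v (suc n) (suc j) - t) - p² ⋆ V (suc j)) ≡ ρ ⋆ error₁ j
      eq = begin
        π ⋆ series c² (suc j) - (recipℕ (2 * suc n) ⋆ (0ℚ - v (suc n) (suc j) - t) - p² ⋆ V (suc j))
          ≡⟨ cong₂ (λ a b → π ⋆ a - b) (series-recip c²≡ (suc j)) (cong₂ _-_ (cong₂ (λ a b → a ⋆ (0ℚ - b - t)) (recipℕ-* 2 (suc n)) (v≡ (suc n) j)) (cong (p² ⋆_) (V-suc j))) ⟩
        π ⋆ (ρ ⋆ s) - (½ ⋆ ρp ⋆ (0ℚ - (- (ρ ⋆ (ι (suc n) ⋆ w))) - t) - p² ⋆ ((- ρ) ⋆ W j))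
          ≡⟨ solve 9 (λ π ρ s ρp m w t p² W → π :* (ρ :* s) :- (con ½ :* ρp :* (con 0ℚ :- (:- (ρ :* (m :* w))) :- t) :- p² :* ((:- ρ) :* W))
               := π :* (ρ :* s) :- (con ½ :* ((ρp :* m) :* (ρ :* w) :- ρp :* t) :- p² :* ((:- ρ) :* W))) refl π ρ s ρp (ι (suc n)) w t p² (W j) ⟩
        π ⋆ (ρ ⋆ s) - (½ ⋆ ((ρp ⋆ ι (suc n)) ⋆ (ρ ⋆ w) - ρp ⋆ t) - p² ⋆ ((- ρ) ⋆ W j))
          -- The dangerous factor 1/p disappears: in the v_p term it meets the factor p of `v≡`, and
          -- on tᵖ it equals 1/(j+1).
          ≡⟨ cong₂ (λ a b → π ⋆ (ρ ⋆ s) - (½ ⋆ (a ⋆ (ρ ⋆ w) - b) - p² ⋆ ((- ρ) ⋆ W j))) (recipℕ⋆ι n) (recip-T^ (suc n) (suc j)) ⟩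
        π ⋆ (ρ ⋆ s) - (½ ⋆ (1ℚ ⋆ (ρ ⋆ w) - ρ ⋆ t) - p² ⋆ ((- ρ) ⋆ W j))
          ≡⟨ solve 7 (λ π ρ s w t p² W → π :* (ρ :* s) :- (con ½ :* (con 1ℚ :* (ρ :* w) :- ρ :* t) :- p² :* ((:- ρ) :* W))
               := ρ :* (π :* s :- (con ½ :* (w :- t) :+ p² :* W))) refl π ρ s w t p² (W j) ⟩
        ρ ⋆ error₁ j
          ∎

  congruence₃ : CongP (suc n) 1 (π · sumP n (λ k → Hc k · T^ k)) (T ⊗ sumU)
  congruence₃ i = Div⇒InPowZp (subst (Div 1) (sym (trans (coeff-⊖ (π · sumP n (λ k → Hc k · T^ k)) (T ⊗ sumU) i)
    (cong₂ _-_ (coeff-series Hc i) (coeff-T⊗ sumU i)))) (cases i))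
    where
    cases : ∀ i → Div 1 (π ⋆ series Hc i - coeff (0ℚ ∷ sumU) i)
    cases zero    = subst (Div 1) (sym (trans (cong (λ s → π ⋆ s - 0ℚ) (series-zero Hc)) (solve 1 (λ π → π :* con 0ℚ :- con 0ℚ := con 0ℚ) refl π))) (Div-0 1)
    cases (suc j) = subst (λ w → Div 1 (π ⋆ series Hc (suc j) - w)) (sym (coeff-sumU j)) (proj₁ (Div-error₃ j))

  congruence₄ : CongP (suc n) 1 (π · sumP n (λ k → (H (k ∸ 1) 2 ⋆ c² k) · T^ k)) (⊝ sumV)
  congruence₄ i = Div⇒InPowZp (subst (Div 1) (sym (trans (coeff-⊖ (π · sumP n (λ k → Hc² k · T^ k)) (⊝ sumV) i)
    (cong₂ _-_ (coeff-series Hc² i) (trans (coeff-⊝ sumV i) (cong -_ (coeff-sumV i)))))) (cases i))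
    where
    Hc² : ℕ → ℚ
    Hc² k = H (k ∸ 1) 2 ⋆ c² k
    Hc²≡ : ∀ k → Hc² k ≡ recipℕ k ⋆ Hc k
    Hc²≡ k = trans (cong (H (k ∸ 1) 2 ⋆_) (c²≡ k))
      (solve 3 (λ h x c → h :* (x :* c) := x :* (h :* c)) refl (H (k ∸ 1) 2) (recipℕ k) (c k))
    cases : ∀ i → Div 1 (π ⋆ series Hc² i - (- V i))
    cases zero    = subst (Div 1) (sym (trans (cong (λ s → π ⋆ s - (- V 0)) (series-zero Hc²))
      (solve 2 (λ π b → π :* con 0ℚ :- (:- b) := b) refl π (V 0)))) V-zero
    cases (suc j) = subst (Div 1) (sym (trans (cong₂ (λ s t → π ⋆ s - (- t)) (series-recip Hc²≡ (suc j)) (V-suc j))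
      (solve 4 (λ π ρ s w → π :* (ρ :* s) :- (:- ((:- ρ) :* w)) := ρ :* (π :* s :- w)) refl π (recipℕ (suc j)) (series Hc (suc j)) (W j))))
      (proj₂ (Div-error₃ j))

theorem6p1 : (p : ℕ) → Prime p → 3 < p →
    CongP p 3
    (ℕ→ℚ p · sumP (p ∸ 1) (λ k → recipℕ (k * ((2 * k) C k)) · T^ k))
    (recipℕ 2 · ((T ⊗ (lucasU p ∘P twoMinusT)) ⊖ T^ p)
    ⊕ ℕ→ℚ (p ^ 2) · (T ⊗ sumP (p ∸ 1) (λ k → recipℕ (k ^ 2) · (lucasU k ∘P twoMinusT))))
    × CongP p 3
    (ℕ→ℚ p · sumP (p ∸ 1) (λ k → recipℕ (k ^ 2 * ((2 * k) C k)) · T^ k))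
    ((recipℕ (2 * p) · ((const (ℕ→ℚ 2) ⊖ (lucasV p ∘P twoMinusT)) ⊖ T^ p))
    ⊖ ℕ→ℚ (p ^ 2) · sumP (p ∸ 1) (λ k → recipℕ (k ^ 3) · (lucasV k ∘P twoMinusT)))
    × CongP p 1
    (ℕ→ℚ p · sumP (p ∸ 1) (λ k → (H (k ∸ 1) 2 Data.Rational.* recipℕ (k * ((2 * k) C k))) · T^ k))
    (T ⊗ sumP (p ∸ 1) (λ k → recipℕ (k ^ 2) · (lucasU k ∘P twoMinusT)))
    × CongP p 1
    (ℕ→ℚ p · sumP (p ∸ 1) (λ k → (H (k ∸ 1) 2 Data.Rational.* recipℕ (k ^ 2 * ((2 * k) C k))) · T^ k))
    (⊝ sumP (p ∸ 1) (λ k → recipℕ (k ^ 3) · (lucasV k ∘P twoMinusT)))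
theorem6p1 (suc n) isPrime 3<p = congruence₁ , congruence₂ , congruence₃ , congruence₄
  where open Congruences n isPrime 3<p
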